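{- Let $\sigma\le\pi$ be permutations such that the interval $[\sigma,\pi]$ of the permutation pattern poset is single. Then $$\mu(\sigma,\pi)=(-1)^{|\pi|-|\sigma|}\,\mathrm{NE}(\sigma,\pi).$$
   Context: A permutation of length $n\ge 1$ is written in one-line notation $\pi=\pi_1\cdots\pi_n$, and $|\pi|=n$. An occurrence of $\sigma$ in $\pi$ is a subsequence of $\pi$ (a choice of positions) whose letters are in the same relative order of size as the letters of $\sigma$. The poset $\mathcal{P}$ is the set of all permutations with $\sigma\le\pi$ iff there is an occurrence of $\sigma$ in $\pi$; $[\sigma,\pi]=\{\lambda:\sigma\le\lambda\le\pi\}$ and $[\sigma,\pi)=\{\lambda: \sigma\le\lambda<\pi\}$. $\mu$ is the Möbius function of $\mathcal{P}$: $\mu(a,b)=0$ if $a\not\le b$, $\mu(a,a)=1$, and $\mu(a,b)=-\sum_{a\le z<b}\mu(a,z)$ for $a<b$. An adjacency in a permutation $\pi$ is a maximal sequence (of length $\ge 1$) of letters in consecutive positions that have consecutive values and are increasing or decreasing. The adjacencies partition the positions of $\pi$. The tail of an adjacency of length at least 2 is all but its first letter; an adjacency of length 1 has no tail. An embedding $\eta$ of $\sigma$ in $\pi$ is a sequence of length $|\pi|$ whose nonzero letters are the letters of an occurrence of $\sigma$ in $\pi$, in the same positions as in $\pi$, all other entries being $0$. An embedding $\eta$ is normal if $\eta_i\neq 0$ at every position $i$ of a letter belonging to the tail of an adjacency of $\pi$. $\mathrm{NE}(\sigma,\pi)$ is the number of normal embeddings of $\sigma$ in $\pi$. Two embeddings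 of $\sigma$ in $\pi$ are equivalent if they differ only within adjacencies of $\pi$, i.e. for every adjacency of $\pi$ they have the same number of nonzero entries among the positions of that adjacency. $\widehat{E}^{\sigma,\pi}$ is the set consisting of the rightmost embedding of each equivalence class, i.e. the one whose nonzero entries within each adjacency occupy the last positions of that adjacency. An interval $[\sigma,\pi]$ has a single block if there is a position $i$ such that $\eta_i=0$ for all $\eta\in\widehat{E}^{\sigma,\pi}$. An interval $[\sigma,\pi]$ is single if for all $\lambda\in[\sigma,\pi)$ the interval $[\lambda,\pi]$ has a single block. -}

module Defs where

open import Data.Bool.Base using (if_then_else_)
open import Data.Fin.Base as Fin using (Fin; zero; suc; toℕ)
import Data.Fin.Properties as Fin
open import Data.Integer.Base as ℤ using (ℤ; +_; -_; 0ℤ; 1ℤ)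
open import Data.List.Base as List using (List; []; _∷_; _++_; length; filter; foldr; mapMaybe; allFin; cartesianProductWith)
open import Data.List.Properties using (map-cong-local)
import Data.List.Relation.Unary.All as All
open import Data.List.Relation.Unary.All.Properties using (all-filter)
open import Data.Maybe.Base using (Maybe; just; nothing)
open import Data.Nat.Base as ℕ using (ℕ; zero; suc; NonZero; s≤s; s≤s⁻¹)
import Data.Nat.Properties as ℕ
open import Data.Product.Base using (_×_; _,_; ∃; proj₁; proj₂; uncurry)
open import Data.Sum.Base using (_⊎_)
open import Data.Vec.Base using (Vec; []; _∷_; lookup; tabulate)
open import Data.Vec.Properties using (≡-dec; lookup∘tabulate; tabulate∘lookup; tabulate-cong)
import Data.Vec.Membership.DecPropositional as Membership
import Data.Vec.Relation.Unary.AllPairs as AllPairs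
open import Data.Vec.Relation.Unary.Unique.Propositional using (Unique)
open import Data.Vec.Relation.Unary.Unique.Propositional.Properties using (lookup-injective)
open import Function.Base using (_∘_; id)
open import Function.Bundles using (_⇔_; mk⇔; Equivalence)
open import Function.Definitions using (Injective)
open import Relation.Binary.Definitions using (tri<; tri≈; tri>)
open import Relation.Binary.PropositionalEquality using (_≡_; _≢_; refl; sym; trans; cong; subst; subst₂)
open import Relation.Nullary using (¬_; Dec; does; yes; no; contradiction; recompute)
open import Relation.Nullary.Decidable using (map′; ¬?; _×-dec_; _⊎-dec_; _→-dec_; dec-true; dec-false)
open import Relation.Unary using (Decidable)

private
  variable
    k m n : ℕ

------------------------------------------------------------------------
-- Permutations in one-line notation

-- Letters and positions are numbered from 0, so a permutation of
-- length n has the letters 0, …, n - 1.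

record Perm : Set where
  constructor perm
  field
    size         : ℕ
    .⦃ nonEmpty ⦄ : NonZero size
    word         : Vec (Fin size) size
    .distinct    : Unique word

open Perm public using (size; word)

letter : (π : Perm) → Fin (size π) → Fin (size π)
letter π = lookup (word π)

unique? : Decidable (Unique {A = Fin m} {n})
unique? = AllPairs.allPairs? (λ x y → ¬? (x Fin.≟ y))

infix 4 _≟_
_≟_ : (σ π : Perm) → Dec (σ ≡ π)
perm m u _ ≟ perm n v _ with m ℕ.≟ n
... | no m≢n   = no λ { refl → m≢n refl }
... | yes refl = map′ (λ { refl → refl }) (λ { refl → refl }) (≡-dec Fin._≟_ u v)

------------------------------------------------------------------------
-- Finite search and enumeration

-- Every vector over Fin m of length k, exactly once.
words : (m k : ℕ) → List (Vec (Fin m) k)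
words m zero    = [] ∷ []
words m (suc k) = cartesianProductWith _∷_ (allFin m) (words m k)

anyWord? : {P : Vec (Fin m) k → Set} → Decidable P → Dec (∃ P)
anyWord? {k = zero}  P? = map′ ([] ,_) (λ { ([] , p) → p }) (P? [])
anyWord? {k = suc _} P? =
  map′ (λ { (x , xs , p) → x ∷ xs , p }) (λ { (x ∷ xs , p) → x , xs , p })
       (Fin.any? λ x → anyWord? λ xs → P? (x ∷ xs))

permsOfSize : (n : ℕ) .⦃ _ : NonZero n ⦄ → List Perm
permsOfSize n = mapMaybe toPerm (words n n)
  where
  toPerm : Vec (Fin n) n → Maybe Perm
  toPerm w with unique? w
  ... | yes u = just (perm n w u)
  ... | no  _ = nothing

permsUpTo : ℕ → List Perm
permsUpTo zero    = []
permsUpTo (suc n) = permsUpTo n ++ permsOfSize (suc n)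

------------------------------------------------------------------------
-- The pattern poset

Increasing : Vec (Fin n) k → Set
Increasing p = ∀ i j → i Fin.< j → lookup p i Fin.< lookup p j

-- An occurrence is given by the increasing list of its positions in π.
Occurrence : (σ π : Perm) → Vec (Fin (size π)) (size σ) → Set
Occurrence σ π p = Increasing p ×
  (∀ i j → letter σ i Fin.< letter σ j ⇔ letter π (lookup p i) Fin.< letter π (lookup p j))

occurrence? : (σ π : Perm) → Decidable (Occurrence σ π)
occurrence? σ π p =
  (Fin.all? λ i → Fin.all? λ j → (i Fin.<? j) →-dec (lookup p i Fin.<? lookup p j))
  ×-dec
  (Fin.all? λ i → Fin.all? λ j →
    (letter σ i Fin.<? letter σ j) ⇔-dec (letter π (lookup p i) Fin.<? letter π (lookup p j)))
  where
  _⇔-dec_ : {A B : Set} → Dec A → Dec B → Dec (A ⇔ B)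
  a? ⇔-dec b? = map′ (uncurry mk⇔) (λ e → Equivalence.to e , Equivalence.from e)
                     ((a? →-dec b?) ×-dec (b? →-dec a?))

infix 4 _≼_ _≼?_ _≺_ _≺?_

_≼_ : Perm → Perm → Set
σ ≼ π = ∃ (Occurrence σ π)

_≼?_ : (σ π : Perm) → Dec (σ ≼ π)
σ ≼? π = anyWord? (occurrence? σ π)

_≺_ : Perm → Perm → Set
σ ≺ π = σ ≼ π × σ ≢ π

_≺?_ : (σ π : Perm) → Dec (σ ≺ π)
σ ≺? π = σ ≼? π ×-dec ¬? (σ ≟ π)

------------------------------------------------------------------------
-- The Möbius function

-- The elements z with a ≼ z ≺ b; all of them have size at most that of b.
[_,_⟩ : Perm → Perm → List Perm
[ a , b ⟩ = filter (λ z → a ≼? z ×-dec z ≺? b) (permsUpTo (size b))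

sumℤ : List ℤ → ℤ
sumℤ = foldr ℤ._+_ 0ℤ

-- The recursion decreases the size of the second argument, so it never
-- runs out of fuel when the fuel exceeds that size; see the equations
-- μ-⋠, μ-refl and μ-≺ below.
μ-fuel : ℕ → Perm → Perm → ℤ
μ-fuel zero    a b = 0ℤ
μ-fuel (suc f) a b =
  if does (a ≼? b)
  then (if does (a ≟ b) then 1ℤ else - sumℤ (List.map (μ-fuel f a) [ a , b ⟩))
  else 0ℤ

μ : Perm → Perm → ℤ
μ a b = μ-fuel (suc (size b)) a b

------------------------------------------------------------------------
-- Embeddings

-- The entry suc x stands for the nonzero letter x, and zero for 0.
Seq : Perm → Set
Seq π = Vec (Fin (suc (size π))) (size π)

embed : (π : Perm) → Vec (Fin (size π)) k → Seq π
embed π p = tabulate λ i → if does (i ∈? p) then suc (letter π i) else zero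
  where open Membership Fin._≟_ using (_∈?_)

IsEmbedding : (σ π : Perm) → Seq π → Set
IsEmbedding σ π η = ∃ λ p → Occurrence σ π p × η ≡ embed π p

isEmbedding? : (σ π : Perm) → Decidable (IsEmbedding σ π)
isEmbedding? σ π η = anyWord? λ p → occurrence? σ π p ×-dec ≡-dec Fin._≟_ η (embed π p)

------------------------------------------------------------------------
-- Adjacencies, encoded by their first and last positions

Ascending Descending Run Adjacency : (π : Perm) (a b : Fin (size π)) → Set

Ascending π a b = ∀ i j → a Fin.≤ i → j Fin.≤ b → toℕ j ≡ suc (toℕ i) →
  toℕ (letter π j) ≡ suc (toℕ (letter π i))

Descending π a b = ∀ i j → a Fin.≤ i → j Fin.≤ b → toℕ j ≡ suc (toℕ i) →
  toℕ (letter π i) ≡ suc (toℕ (letter π j))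

Run π a b = a Fin.≤ b × (Ascending π a b ⊎ Descending π a b)

Adjacency π a b = Run π a b ×
  (∀ c d → Run π c d → c Fin.≤ a → b Fin.≤ d → c ≡ a × d ≡ b)

run? : ∀ π a b → Dec (Run π a b)
run? π a b = a Fin.≤? b ×-dec
  ((Fin.all? λ i → Fin.all? λ j → (a Fin.≤? i) →-dec ((j Fin.≤? b) →-dec
     ((toℕ j ℕ.≟ suc (toℕ i)) →-dec (toℕ (letter π j) ℕ.≟ suc (toℕ (letter π i))))))
   ⊎-dec
   (Fin.all? λ i → Fin.all? λ j → (a Fin.≤? i) →-dec ((j Fin.≤? b) →-dec
     ((toℕ j ℕ.≟ suc (toℕ i)) →-dec (toℕ (letter π i) ℕ.≟ suc (toℕ (letter π j)))))))

adjacency? : ∀ π a b → Dec (Adjacency π a b)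
adjacency? π a b = run? π a b ×-dec
  (Fin.all? λ c → Fin.all? λ d → run? π c d →-dec
    ((c Fin.≤? a) →-dec ((b Fin.≤? d) →-dec (c Fin.≟ a ×-dec d Fin.≟ b))))

------------------------------------------------------------------------
-- Normal embeddings

Normal : (π : Perm) → Seq π → Set
Normal π η = ∀ a b → Adjacency π a b →
  ∀ i → a Fin.< i → i Fin.≤ b → lookup η i ≢ zero

normal? : (π : Perm) → Decidable (Normal π)
normal? π η = Fin.all? λ a → Fin.all? λ b → adjacency? π a b →-dec
  (Fin.all? λ i → (a Fin.<? i) →-dec ((i Fin.≤? b) →-dec ¬? (lookup η i Fin.≟ zero)))

NE : Perm → Perm → ℕ
NE σ π = length (filter (λ η → isEmbedding? σ π η ×-dec normal? π η)
                        (words (suc (size π)) (size π)))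

------------------------------------------------------------------------
-- Rightmost embeddings and single intervals

nonzerosWithin : Vec (Fin (suc m)) n → (a b : Fin n) → ℕ
nonzerosWithin {n = n} η a b = length (filter
  (λ i → (a Fin.≤? i ×-dec i Fin.≤? b) ×-dec ¬? (lookup η i Fin.≟ zero)) (allFin n))

Equivalent : (π : Perm) (η θ : Seq π) → Set
Equivalent π η θ = ∀ a b → Adjacency π a b → nonzerosWithin η a b ≡ nonzerosWithin θ a b

Rightmost : (π : Perm) → Seq π → Set
Rightmost π η = ∀ a b → Adjacency π a b →
  ∀ i j → a Fin.≤ i → i Fin.< j → j Fin.≤ b → lookup η i ≢ zero → lookup η j ≢ zero

-- η is the rightmost member of the equivalence class of some embedding θ.
Ê : (σ π : Perm) → Seq π → Set
Ê σ π η = ∃ λ θ → IsEmbedding σ π θ ×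
  (IsEmbedding σ π η × Equivalent π η θ × Rightmost π η)

SingleBlock : (σ π : Perm) → Set
SingleBlock σ π = ∃ λ i → ∀ η → Ê σ π η → lookup η i ≡ zero

Single : (σ π : Perm) → Set
Single σ π = ∀ τ → σ ≼ τ → τ ≺ π → SingleBlock τ π

------------------------------------------------------------------------
-- The defining equations of the Möbius function

private
  StrictMono : (Fin m → Fin n) → Set
  StrictMono f = ∀ i j → i Fin.< j → f i Fin.< f j

  mono⇒reflects : {f : Fin m → Fin n} → StrictMono f → ∀ i j → f i Fin.< f j → i Fin.< j
  mono⇒reflects {f = f} mono i j fi<fj with Fin.<-cmp i j
  ... | tri< i<j _ _  = i<j
  ... | tri≈ _ refl _ = contradiction fi<fj (ℕ.<-irrefl refl)
  ... | tri> _ _ j<i  = contradiction (mono j i j<i) (ℕ.<-asym fi<fj)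

  mono⇒injective : {f : Fin m → Fin n} → StrictMono f → Injective _≡_ _≡_ f
  mono⇒injective {f = f} mono {i} {j} eq with Fin.<-cmp i j
  ... | tri< i<j _ _ = contradiction (mono i j i<j) (ℕ.<-irrefl (cong toℕ eq))
  ... | tri≈ _ i≡j _ = i≡j
  ... | tri> _ _ j<i = contradiction (mono j i j<i) (ℕ.<-irrefl (cong toℕ (sym eq)))

  mono⇒inflationary : {f : Fin m → Fin n} → StrictMono f → ∀ i → i Fin.≤ f i
  mono⇒inflationary {f = f} mono i
    with j , j≤i , i≤fj ← Fin.injective⇒existsPivot (mono⇒injective mono) i
    with Fin.<-cmp j i
  ... | tri< j<i _ _  = ℕ.≤-trans i≤fj (ℕ.<⇒≤ (mono j i j<i))
  ... | tri≈ _ refl _ = i≤fj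
  ... | tri> _ _ i<j  = contradiction i<j (ℕ.≤⇒≯ j≤i)

  injective⇒surjective : {f : Fin n → Fin n} → Injective _≡_ _≡_ f → ∀ y → ∃ λ x → f x ≡ y
  injective⇒surjective {suc n} {f} inj y with Fin.any? (λ x → f x Fin.≟ y)
  ... | yes found = found
  ... | no  avoid = contradiction
    (Fin.injective⇒≤ {f = λ x → Fin.punchOut (miss x)}
      (λ {x} {x′} eq → inj (Fin.punchOut-injective (miss x) (miss x′) eq)))
    ℕ.1+n≰n
    where
    miss : ∀ x → y ≢ f x
    miss x eq = avoid (x , sym eq)

  order⇒≤ : {u v : Fin n → Fin n} → Injective _≡_ _≡_ u →
            (∀ i j → u i Fin.< u j → v i Fin.< v j) → ∀ i → u i Fin.≤ v i
  order⇒≤ {u = u} {v} inj uv i =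
    subst (λ j → u i Fin.≤ v j) (inj (proj₂ (u⁻¹ (u i))))
      (mono⇒inflationary {f = λ x → v (proj₁ (u⁻¹ x))}
        (λ x y x<y → uv _ _ (subst₂ Fin._<_ (sym (proj₂ (u⁻¹ x))) (sym (proj₂ (u⁻¹ y))) x<y)) (u i))
    where
    u⁻¹ = injective⇒surjective inj

  letter-injective : ∀ π → Injective _≡_ _≡_ (letter π)
  letter-injective (perm _ w d) = lookup-injective (recompute (unique? w) d) _ _

  ≼-sameSize : ∀ σ π → σ ≼ π → size σ ≡ size π → σ ≡ π
  ≼-sameSize σ@(perm n u _) π@(perm .n v _) (p , inc , ord) refl = equalWords u≡v
    where
    p-id : ∀ i → lookup p i ≡ i
    p-id i = Fin.≤-antisym
      (order⇒≤ (mono⇒injective inc) (mono⇒reflects inc) i)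
      (mono⇒inflationary inc i)

    ord′ : ∀ i j → lookup u i Fin.< lookup u j ⇔ lookup v i Fin.< lookup v j
    ord′ i j = subst (λ x → _ ⇔ lookup v x Fin.< lookup v j) (p-id i)
      (subst (λ y → _ ⇔ lookup v (lookup p i) Fin.< lookup v y) (p-id j) (ord i j))

    u≡v : u ≡ v
    u≡v = trans (sym (tabulate∘lookup u)) (trans (tabulate-cong λ i → Fin.≤-antisym
      (order⇒≤ (letter-injective σ) (λ i j → Equivalence.to   (ord′ i j)) i)
      (order⇒≤ (letter-injective π) (λ i j → Equivalence.from (ord′ i j)) i))
      (tabulate∘lookup v))

    equalWords : u ≡ v → σ ≡ π
    equalWords refl = refl

≺⇒size< : ∀ {σ π} → σ ≺ π → size σ ℕ.< size π
≺⇒size< {σ} {π} (σ≼π@(_ , inc , _) , σ≢π) =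
  ℕ.≤∧≢⇒< (Fin.injective⇒≤ (mono⇒injective inc)) (σ≢π ∘ ≼-sameSize σ π σ≼π)

≼-refl : ∀ σ → σ ≼ σ
≼-refl σ = tabulate id ,
  (λ i j → subst₂ Fin._<_ (sym (look i)) (sym (look j))) ,
  (λ i j → subst₂ (λ x y → letter σ i Fin.< letter σ j ⇔ letter σ x Fin.< letter σ y)
             (sym (look i)) (sym (look j)) (mk⇔ id id))
  where
  look : ∀ i → lookup (tabulate id) i ≡ i
  look = lookup∘tabulate id

private
  μ-fuel-irrelevant : ∀ f g a b → size b ℕ.< f → size b ℕ.< g → μ-fuel f a b ≡ μ-fuel g a b
  μ-fuel-irrelevant (suc f) (suc g) a b (s≤s b≤f) (s≤s b≤g) =
    cong (λ s → if does (a ≼? b) then (if does (a ≟ b) then 1ℤ else - sumℤ s) else 0ℤ)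
      (map-cong-local (All.map
        (λ {z} (_ , z≺b) → μ-fuel-irrelevant f g a z
          (ℕ.<-≤-trans (≺⇒size< z≺b) b≤f) (ℕ.<-≤-trans (≺⇒size< z≺b) b≤g))
        (all-filter _ (permsUpTo (size b)))))

μ-⋠ : ∀ {a b} → ¬ a ≼ b → μ a b ≡ 0ℤ
μ-⋠ {a} {b} a⋠b rewrite dec-false (a ≼? b) a⋠b = refl

μ-refl : ∀ {a} → μ a a ≡ 1ℤ
μ-refl {a} rewrite dec-true (a ≼? a) (≼-refl a) | dec-true (a ≟ a) refl = refl

μ-≺ : ∀ {a b} → a ≺ b → μ a b ≡ - sumℤ (List.map (μ a) [ a , b ⟩)
μ-≺ {a} {b} (a≼b , a≢b)
  rewrite dec-true (a ≼? b) a≼b | dec-false (a ≟ b) a≢b =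
  cong (-_ ∘ sumℤ) (map-cong-local (All.map
    (λ {z} (_ , z≺b) → μ-fuel-irrelevant (size b) (suc (size z)) a z (≺⇒size< z≺b) ℕ.≤-refl)
    (all-filter _ (permsUpTo (size b)))))

{-# OPTIONS --safe #-}

-- Weight τ by (-1)^(|π| - |τ|) NE(τ,π).  It suffices that the weights of the
-- τ ≽ ζ sum to [ζ = π] for each ζ in [σ,π]: multiplying by μ(σ,ζ), summing over
-- ζ and exchanging the sums then leaves the weight of σ.  For ζ ≺ π the sum is
-- a signed count of the normal embeddings η in π whose letters contain ζ.  As η
-- contains the tails of all adjacencies, it contains the rightmost version of
-- every embedding of ζ it contains.  All rightmost embeddings vanish at one position i, and
-- since they are rightmost, i can be moved to the head of its adjacency.
-- Toggling the letter at i then is a sign-reversing involution.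

module Submission where

open import Defs
open import Data.Integer.Base using (+_; -1ℤ; _*_; _^_)
open import Data.Nat.Base using (_∸_)
open import Relation.Binary.PropositionalEquality using (_≡_)

open import Data.Bool.Base using (true; false; if_then_else_)
open import Data.Fin.Base as Fin using (Fin; zero; suc; toℕ; fromℕ<)
import Data.Fin.Properties as Fin
open import Data.Integer.Base as ℤ using (ℤ; -_; 0ℤ; 1ℤ; _+_)
import Data.Integer.Properties as ℤ
open import Data.Integer.Tactic.RingSolver using (solve-∀)
open import Data.List.Base using (List; []; _∷_; length; filter; map; mapMaybe)
open import Data.List.Membership.Propositional using () renaming (_∈_ to _∈ᴸ_)
open import Data.List.Membership.Propositional.Properties
  using (∈-map⁺; ∈-++⁺ˡ; ∈-++⁺ʳ; ∈-++⁻; ∈-allFin; ∈-cartesianProductWith⁺; ∈-filter⁺; ∈-filter⁻)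
open import Data.List.Membership.Propositional.Properties.WithK using (unique∧set⇒bag)
open import Data.List.Properties using (map-∘)
open import Data.List.Relation.Binary.BagAndSetEquality using (∼bag⇒↭)
open import Data.List.Relation.Binary.Permutation.Propositional using (_↭_; ↭⇒↭ₛ)
import Data.List.Relation.Binary.Permutation.Propositional.Properties as ↭
open import Data.List.Relation.Binary.Permutation.Setoid.Properties using (foldr-commMonoid)
open import Data.List.Relation.Unary.All as All using ([]; _∷_)
open import Data.List.Relation.Unary.AllPairs using ([]; _∷_)
open import Data.List.Relation.Unary.Any using (here; there)
open import Data.List.Relation.Unary.Unique.Propositional using (Unique)
import Data.List.Relation.Unary.Unique.Propositional.Properties as Unique
open import Data.Maybe.Base using (Maybe; just; nothing)
open import Data.Nat.Base as ℕ using (ℕ; zero; suc; NonZero; z≤n; s≤s; z<s)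
open import Data.Nat.Induction using (Acc; acc; <-wellFounded)
import Data.Nat.Properties as ℕ
open import Data.Product.Base using (_×_; _,_; ∃; ∃₂; proj₁; proj₂)
open import Data.Sum.Base as Sum using (_⊎_; inj₁; inj₂; [_,_]′)
open import Data.Vec.Base as Vec using (Vec; []; _∷_; lookup; tabulate; allFin; updateAt)
import Data.Vec.Membership.DecPropositional as Membership
open import Data.Vec.Membership.Propositional using (_∈_; _∉_)
open import Data.Vec.Membership.Propositional.Properties as Vec using (∈-lookup; ∈-allFin⁺)
open import Data.Vec.Properties as Vec using (lookup∘tabulate; tabulate∘lookup; tabulate-cong; lookup-map;
  lookup∘updateAt; lookup∘updateAt′; updateAt-updateAt; updateAt-id-local)
open import Data.Vec.Relation.Unary.Any using (here; there; index)
open import Data.Vec.Relation.Unary.Any.Properties using (lookup-index)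
open import Data.Vec.Relation.Unary.Unique.Propositional.Properties using (lookup-injective; tabulate⁺)
open import Function.Base using (_∘_; id)
open import Function.Bundles using (_⇔_; mk⇔)
open import Function.Definitions using (Injective)
open import Function.Properties.Equivalence using () renaming (sym to ⇔-sym; trans to ⇔-trans)
open import Relation.Binary.Definitions using (tri<; tri≈; tri>)
open import Relation.Binary.PropositionalEquality
  using (_≢_; refl; sym; trans; cong; cong₂; subst; subst₂; setoid; module ≡-Reasoning)
open import Relation.Nullary using (¬_; Dec; does; yes; no; contradiction; recompute)
open import Relation.Nullary.Decidable using (_×-dec_; ¬?; dec-true; dec-false; decidable-stable; toSum)
open import Relation.Unary using (Decidable)

-- Normality is what makes the toggle safe. For `π = 12` and `ζ = 1` the only rightmost embedding is
-- `02`, so `i` is the first position; the embedding `10` also contains `ζ`, but only through `i`,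
-- and the toggle would empty it. The normal sequences `02` and `12` do cancel each other.
-- Conversely `i` has to be a head, since deleting a tail letter destroys normality. The signed
-- count is organised by sequences rather than by patterns. An embedding determines its pattern, so
-- the sum over `τ` and `η` collapses to a sum over all sequences on which the toggle acts directly;
-- the pattern only has to be recovered afterwards, to see that its size has changed by one.

private
  variable
    A B : Set
    k l m n : ℕ

-- Finite sums

∑ : List A → (A → ℤ) → ℤ
∑ xs f = sumℤ (map f xs)

abstract

  -- The Iverson bracket, kept opaque because the decisions it is applied to are exhaustive searches
  -- that should not be unfolded.
  ⟦_⟧ : {P : Set} → Dec P → ℤ
  ⟦ p? ⟧ = if does p? then 1ℤ else 0ℤ

  ⟦⟧-true : {P : Set} (p? : Dec P) → P → ⟦ p? ⟧ ≡ 1ℤ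
  ⟦⟧-true p? p = cong (if_then 1ℤ else 0ℤ) (dec-true p? p)

  ⟦⟧-false : {P : Set} (p? : Dec P) → ¬ P → ⟦ p? ⟧ ≡ 0ℤ
  ⟦⟧-false p? ¬p = cong (if_then 1ℤ else 0ℤ) (dec-false p? ¬p)

  ⟦⟧≢0 : {P : Set} (p? : Dec P) → ⟦ p? ⟧ ≢ 0ℤ → P
  ⟦⟧≢0 (yes p) _  = p
  ⟦⟧≢0 (no _)  ≢0 = contradiction refl ≢0

  ⟦⟧*≢0 : {P : Set} (p? : Dec P) {c : ℤ} → ⟦ p? ⟧ * c ≢ 0ℤ → P × c ≢ 0ℤ
  ⟦⟧*≢0 (yes p) {c} ≢0 = p , λ c≡0 → ≢0 (trans (ℤ.*-identityˡ c) c≡0)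
  ⟦⟧*≢0 (no _)  ≢0 = contradiction refl ≢0

  length-filter : {P : A → Set} (P? : Decidable P) (xs : List A) →
                  + length (filter P? xs) ≡ ∑ xs (λ x → ⟦ P? x ⟧)
  length-filter P? []       = refl
  length-filter P? (x ∷ xs) with P? x
  ... | yes _ = cong (λ s → 1ℤ + s) (length-filter P? xs)
  ... | no  _ = trans (length-filter P? xs) (sym (ℤ.+-identityˡ _))

⟦⟧*-true : {P : Set} (p? : Dec P) {c : ℤ} → P → ⟦ p? ⟧ * c ≡ c
⟦⟧*-true p? {c} p = trans (cong (_* c) (⟦⟧-true p? p)) (ℤ.*-identityˡ c)

∑-cong-∈ : (xs : List A) {f g : A → ℤ} → (∀ {x} → x ∈ᴸ xs → f x ≡ g x) → ∑ xs f ≡ ∑ xs g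
∑-cong-∈ []       f≡g = refl
∑-cong-∈ (x ∷ xs) f≡g = cong₂ _+_ (f≡g (here refl)) (∑-cong-∈ xs (f≡g ∘ there))

∑-cong : (xs : List A) {f g : A → ℤ} → (∀ x → f x ≡ g x) → ∑ xs f ≡ ∑ xs g
∑-cong xs f≡g = ∑-cong-∈ xs (λ {x} _ → f≡g x)

∑-zero : (xs : List A) → ∑ xs (λ _ → 0ℤ) ≡ 0ℤ
∑-zero []       = refl
∑-zero (x ∷ xs) = trans (ℤ.+-identityˡ _) (∑-zero xs)

∑-+ : (xs : List A) (f g : A → ℤ) → ∑ xs (λ x → f x + g x) ≡ ∑ xs f + ∑ xs g
∑-+ []       f g = refl
∑-+ (x ∷ xs) f g = trans (cong (λ s → f x + g x + s) (∑-+ xs f g)) (interchange (f x) (g x) (∑ xs f) (∑ xs g))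
  where
  interchange : ∀ a b c d → (a + b) + (c + d) ≡ (a + c) + (b + d)
  interchange = solve-∀

∑-*ˡ : (c : ℤ) (xs : List A) (f : A → ℤ) → c * ∑ xs f ≡ ∑ xs (λ x → c * f x)
∑-*ˡ c []       f = ℤ.*-zeroʳ c
∑-*ˡ c (x ∷ xs) f = trans (ℤ.*-distribˡ-+ c (f x) _) (cong (λ s → c * f x + s) (∑-*ˡ c xs f))

∑-neg : (xs : List A) (f : A → ℤ) → ∑ xs (λ x → - f x) ≡ - ∑ xs f
∑-neg []       f = refl
∑-neg (x ∷ xs) f = trans (cong (λ s → - f x + s) (∑-neg xs f)) (sym (ℤ.neg-distrib-+ (f x) _))

∑-swap : (xs : List A) (ys : List B) (f : A → B → ℤ) →
         ∑ xs (λ x → ∑ ys (f x)) ≡ ∑ ys (λ y → ∑ xs (λ x → f x y))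
∑-swap []       ys f = sym (∑-zero ys)
∑-swap (x ∷ xs) ys f = trans (cong (λ s → ∑ ys (f x) + s) (∑-swap xs ys f)) (sym (∑-+ ys (f x) _))

∑≢0 : (xs : List A) (f : A → ℤ) → ∑ xs f ≢ 0ℤ → ∃ λ x → x ∈ᴸ xs × f x ≢ 0ℤ
∑≢0 []       f ≢0 = contradiction refl ≢0
∑≢0 (x ∷ xs) f ≢0 with f x ℤ.≟ 0ℤ
... | no  fx≢0 = x , here refl , fx≢0
... | yes fx≡0 with y , y∈xs , fy≢0 ← ∑≢0 xs f (λ eq → ≢0 (cong₂ _+_ fx≡0 eq)) = y , there y∈xs , fy≢0

∑-↭ : {xs ys : List A} (f : A → ℤ) → xs ↭ ys → ∑ xs f ≡ ∑ ys f
∑-↭ f xs↭ys = foldr-commMonoid (setoid ℤ) ℤ.+-0-isCommutativeMonoid (↭⇒↭ₛ (↭.map⁺ f xs↭ys))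

module _ (f : A → ℤ) where

  private
    nonzero? : Decidable (λ x → f x ≢ 0ℤ)
    nonzero? x = ¬? (f x ℤ.≟ 0ℤ)

    ∑-filter : ∀ xs → ∑ (filter nonzero? xs) f ≡ ∑ xs f
    ∑-filter []       = refl
    ∑-filter (x ∷ xs) with f x ℤ.≟ 0ℤ
    ... | no  _    = cong (λ s → f x + s) (∑-filter xs)
    ... | yes fx≡0 = trans (∑-filter xs) (trans (sym (ℤ.+-identityˡ _)) (cong (_+ ∑ xs f) (sym fx≡0)))

  -- Restricted to the support of `f`, the two duplicate-free lists have the same members and so are
  -- permutations of each other. Sums over different intervals can thus share one index list, with
  -- brackets cutting out the range.
  ∑-support : {xs ys : List A} → Unique xs → Unique ys →
              (∀ {x} → x ∈ᴸ xs → f x ≢ 0ℤ → x ∈ᴸ ys) →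
              (∀ {y} → y ∈ᴸ ys → f y ≢ 0ℤ → y ∈ᴸ xs) → ∑ xs f ≡ ∑ ys f
  ∑-support {xs} {ys} xs! ys! xs⊆ys ys⊆xs = begin
    ∑ xs f                     ≡⟨ ∑-filter xs ⟨
    ∑ (filter nonzero? xs) f   ≡⟨ ∑-↭ f (∼bag⇒↭ (unique∧set⇒bag
                                    (Unique.filter⁺ nonzero? xs!) (Unique.filter⁺ nonzero? ys!)
                                    (mk⇔ (restrict xs⊆ys) (restrict ys⊆xs)))) ⟩
    ∑ (filter nonzero? ys) f   ≡⟨ ∑-filter ys ⟩
    ∑ ys f                     ∎
    where
    open ≡-Reasoning
    restrict : ∀ {us vs} → (∀ {x} → x ∈ᴸ us → f x ≢ 0ℤ → x ∈ᴸ vs) →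
               ∀ {x} → x ∈ᴸ filter nonzero? us → x ∈ᴸ filter nonzero? vs
    restrict {us} us⊆vs x∈ with x∈us , fx≢0 ← ∈-filter⁻ nonzero? {xs = us} x∈ =
      ∈-filter⁺ nonzero? (us⊆vs x∈us fx≢0) fx≢0

  ∑-single : {xs : List A} → Unique xs → ∀ {y} → y ∈ᴸ xs →
             (∀ {x} → x ∈ᴸ xs → f x ≢ 0ℤ → x ≡ y) → ∑ xs f ≡ f y
  ∑-single {xs} xs! {y} y∈xs only =
    trans (∑-support {ys = y ∷ []} xs! ([] ∷ [])
             (λ x∈xs fx≢0 → here (only x∈xs fx≢0)) (λ { (here refl) _ → y∈xs }))
          (ℤ.+-identityʳ (f y))

-- A sign-reversing involution may have fixed points, where f then vanishes.
∑-involution : {xs : List A} → Unique xs → (∀ x → x ∈ᴸ xs) → (t : A → A) → (∀ x → t (t x) ≡ x) →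
               (f : A → ℤ) → (∀ x → f (t x) ≡ - f x) → ∑ xs f ≡ 0ℤ
∑-involution {xs = xs} xs! complete t t∘t f f∘t = x≡-x⇒x≡0 (begin
  ∑ xs f               ≡⟨ ∑-support f (Unique.map⁺ t-injective xs!) xs! (λ _ _ → complete _)
                            (λ {y} _ _ → subst (_∈ᴸ map t xs) (t∘t y) (∈-map⁺ t (complete (t y)))) ⟨
  ∑ (map t xs) f       ≡⟨ cong sumℤ (map-∘ xs) ⟨
  ∑ xs (λ x → f (t x)) ≡⟨ ∑-cong xs f∘t ⟩
  ∑ xs (λ x → - f x)   ≡⟨ ∑-neg xs f ⟩
  - ∑ xs f             ∎)
  where
  open ≡-Reasoning
  t-injective : ∀ {x y} → t x ≡ t y → x ≡ y
  t-injective eq = trans (sym (t∘t _)) (trans (cong t eq) (t∘t _))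
  x≡-x⇒x≡0 : ∀ {x} → x ≡ - x → x ≡ 0ℤ
  -- At a nonzero integer the two sides have different constructors.
  x≡-x⇒x≡0 {+ 0} _ = refl

-- Completeness and uniqueness of the enumerations

∈-words : ∀ {m k} (w : Vec (Fin m) k) → w ∈ᴸ words m k
∈-words []      = here refl
∈-words (x ∷ w) = ∈-cartesianProductWith⁺ _∷_ (∈-allFin x) (∈-words w)

words! : ∀ m k → Unique (words m k)
words! m zero    = [] ∷ []
words! m (suc k) = Unique.cartesianProductWith⁺ _∷_ Vec.∷-injective (Unique.allFin⁺ m) (words! m k)

module _ {f : A → Maybe B} where

  ∈-mapMaybe⁺ : ∀ {xs x y} → x ∈ᴸ xs → f x ≡ just y → y ∈ᴸ mapMaybe f xs
  ∈-mapMaybe⁺ (here refl) eq rewrite eq = here refl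
  ∈-mapMaybe⁺ {x′ ∷ _} (there x∈xs) eq with f x′
  ... | just _  = there (∈-mapMaybe⁺ x∈xs eq)
  ... | nothing = ∈-mapMaybe⁺ x∈xs eq

  ∈-mapMaybe⁻ : ∀ {xs y} → y ∈ᴸ mapMaybe f xs → ∃ λ x → x ∈ᴸ xs × f x ≡ just y
  ∈-mapMaybe⁻ {x ∷ xs} y∈ with f x in eq
  ∈-mapMaybe⁻ {x ∷ xs} (here refl) | just _ = x , here refl , eq
  ∈-mapMaybe⁻ {x ∷ xs} (there y∈)  | just _ with x′ , x′∈xs , eq′ ← ∈-mapMaybe⁻ y∈ = x′ , there x′∈xs , eq′
  ∈-mapMaybe⁻ {x ∷ xs} y∈          | nothing with x′ , x′∈xs , eq′ ← ∈-mapMaybe⁻ y∈ = x′ , there x′∈xs , eq′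

  mapMaybe! : (∀ {x x′ y} → f x ≡ just y → f x′ ≡ just y → x ≡ x′) → ∀ {xs} → Unique xs → Unique (mapMaybe f xs)
  mapMaybe! inj {[]}     []           = []
  mapMaybe! inj {x ∷ xs} (x∉xs ∷ xs!) with f x in eq
  ... | nothing = mapMaybe! inj xs!
  ... | just y  = All.tabulate fresh ∷ mapMaybe! inj xs!
    where
    fresh : ∀ {z} → z ∈ᴸ mapMaybe f xs → y ≢ z
    fresh z∈ refl with x′ , x′∈xs , eq′ ← ∈-mapMaybe⁻ z∈ = All.lookup x∉xs x′∈xs (inj eq eq′)

-- The function local to permsOfSize is out of scope here, and unification recovers it.
private
  mapped : {f : A → Maybe B} (xs : List A) {ys : List B} → ys ≡ mapMaybe f xs → A → Maybe B
  mapped {f = f} _ _ = f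

toPerm : ∀ n .⦃ _ : NonZero n ⦄ → Vec (Fin n) n → Maybe Perm
toPerm n = mapped (words n n) (refl {x = permsOfSize n})

toPerm-just⁺ : ∀ n .⦃ _ : NonZero n ⦄ w .u → toPerm n w ≡ just (perm n w u)
toPerm-just⁺ n w u with unique? w
... | yes _ = refl
... | no ¬u = contradiction (recompute (unique? w) u) ¬u

toPerm-just⁻ : ∀ n .⦃ _ : NonZero n ⦄ {w π} → toPerm n w ≡ just π → ∃ λ u → π ≡ perm n w u
toPerm-just⁻ n {w} eq with unique? w
toPerm-just⁻ n {w} refl | yes u = u , refl

∈-permsOfSize⁺ : ∀ π → π ∈ᴸ permsOfSize (size π)
∈-permsOfSize⁺ (perm n w u) = ∈-mapMaybe⁺ (∈-words w) (toPerm-just⁺ n w u)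

∈-permsOfSize⁻ : ∀ {n} .⦃ _ : NonZero n ⦄ {π} → π ∈ᴸ permsOfSize n → size π ≡ n
∈-permsOfSize⁻ {n} π∈ with w , _ , fw ← ∈-mapMaybe⁻ {xs = words n n} π∈ with _ , refl ← toPerm-just⁻ n {w} fw = refl

permsOfSize! : ∀ n .⦃ _ : NonZero n ⦄ → Unique (permsOfSize n)
permsOfSize! n = mapMaybe! injective (words! n n)
  where
  injective : ∀ {w w′ π} → toPerm n w ≡ just π → toPerm n w′ ≡ just π → w ≡ w′
  injective {w} {w′} eq eq′ with toPerm-just⁻ n {w} eq | toPerm-just⁻ n {w′} eq′
  ... | _ , refl | _ , refl = refl

∈-permsUpTo⁻ : ∀ {n π} → π ∈ᴸ permsUpTo n → size π ℕ.≤ n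
∈-permsUpTo⁻ {suc n} π∈ with ∈-++⁻ (permsUpTo n) π∈
... | inj₁ π∈ˡ = ℕ.m≤n⇒m≤1+n (∈-permsUpTo⁻ π∈ˡ)
... | inj₂ π∈ʳ = ℕ.≤-reflexive (∈-permsOfSize⁻ π∈ʳ)

∈-permsUpTo⁺ : ∀ {n π} → size π ℕ.≤ n → π ∈ᴸ permsUpTo n
∈-permsUpTo⁺ {zero}  {perm zero ⦃ () ⦄ _ _} _
∈-permsUpTo⁺ {suc n} {π} π≤1+n with ℕ.m≤n⇒m<n∨m≡n π≤1+n
... | inj₁ (s≤s π≤n) = ∈-++⁺ˡ (∈-permsUpTo⁺ π≤n)
... | inj₂ refl      = ∈-++⁺ʳ (permsUpTo n) (∈-permsOfSize⁺ π)

permsUpTo! : ∀ n → Unique (permsUpTo n)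
permsUpTo! zero    = []
permsUpTo! (suc n) = Unique.++⁺ (permsUpTo! n) (permsOfSize! (suc n))
  λ (π∈ˡ , π∈ʳ) → ℕ.1+n≰n (subst (ℕ._≤ n) (∈-permsOfSize⁻ π∈ʳ) (∈-permsUpTo⁻ π∈ˡ))

-- Increasing sequences of positions

_⊆_ : Vec (Fin n) k → Vec (Fin n) l → Set
p ⊆ r = ∀ a → lookup p a ∈ r

module _ (p : Vec (Fin n) k) (p↑ : Increasing p) where

  increasing-reflects : ∀ {a b} → lookup p a Fin.< lookup p b → a Fin.< b
  increasing-reflects {a} {b} pa<pb with Fin.<-cmp a b
  ... | tri< a<b _ _  = a<b
  ... | tri≈ _ refl _ = contradiction pa<pb (ℕ.<-irrefl refl)
  ... | tri> _ _ b<a  = contradiction (p↑ b a b<a) (ℕ.<-asym pa<pb)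

  increasing-injective : Injective _≡_ _≡_ (lookup p)
  increasing-injective {a} {b} eq with Fin.<-cmp a b
  ... | tri< a<b _ _ = contradiction (p↑ a b a<b) (ℕ.<-irrefl (cong toℕ eq))
  ... | tri≈ _ a≡b _ = a≡b
  ... | tri> _ _ b<a = contradiction (p↑ b a b<a) (ℕ.<-irrefl (cong toℕ (sym eq)))

∷-lookup-injective : ∀ {x} (p : Vec (Fin n) k) → x ∉ p → Injective _≡_ _≡_ (lookup p) →
                     Injective _≡_ _≡_ (lookup (x ∷ p))
∷-lookup-injective p x∉p inj {zero}  {zero}  eq   = refl
∷-lookup-injective p x∉p inj {zero}  {suc b} refl = contradiction (∈-lookup b p) x∉p
∷-lookup-injective p x∉p inj {suc a} {zero}  refl = contradiction (∈-lookup a p) x∉p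
∷-lookup-injective p x∉p inj {suc a} {suc b} eq   = cong suc (inj eq)

injective-⊆⇒≤ : (p : Vec (Fin n) k) (r : Vec (Fin n) l) → Injective _≡_ _≡_ (lookup p) → p ⊆ r → k ℕ.≤ l
injective-⊆⇒≤ p r inj p⊆r = Fin.injective⇒≤ {f = λ a → index (p⊆r a)} λ {a} {b} eq →
  inj (trans (lookup-index (p⊆r a)) (trans (cong (lookup r) eq) (sym (lookup-index (p⊆r b)))))

-- The injective sequences `r` and `i ∷ p` have the same entries, so the pigeonhole principle bounds
-- each length by the other.
length-insert : (p : Vec (Fin n) k) (r : Vec (Fin n) l) → Increasing p → Increasing r →
                ∀ {i} → i ∉ p → i ∈ r → p ⊆ r → (∀ b → lookup r b ≡ i ⊎ lookup r b ∈ p) → l ≡ suc k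
length-insert p r p↑ r↑ {i} i∉p i∈r p⊆r r⊆i∷p = ℕ.≤-antisym
  (injective-⊆⇒≤ r (i ∷ p) (increasing-injective r r↑) (λ b → [ here , there ]′ (r⊆i∷p b)))
  (injective-⊆⇒≤ (i ∷ p) r (∷-lookup-injective p i∉p (increasing-injective p p↑)) λ { zero → i∈r ; (suc a) → p⊆r a })

-- Turns the support of a sequence back into the increasing list of positions by which an occurrence
-- is given.
enumerate : {P : Fin n → Set} → Decidable P → ∃ λ k → ∃ λ (r : Vec (Fin n) k) →
            Increasing r × (∀ {i} → P i → i ∈ r) × (∀ b → P (lookup r b))
enumerate {zero}          P? = 0 , [] , (λ ()) , (λ { {()} _ }) , λ ()
enumerate {suc n} {P} P? with k , r , r↑ , complete , sound ← enumerate (P? ∘ suc) with P? zero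
... | no ¬P0 = k , Vec.map suc r ,
  (λ a b a<b → subst₂ Fin._<_ (sym (lookup-map a suc r)) (sym (lookup-map b suc r)) (s≤s (r↑ a b a<b))) ,
  (λ { {zero} P0 → contradiction P0 ¬P0 ; {suc i} Pi → Vec.∈-map⁺ suc (complete Pi) }) ,
  λ b → subst P (sym (lookup-map b suc r)) (sound b)
... | yes P0 = suc k , zero ∷ Vec.map suc r ,
  (λ { zero    (suc b) _         → subst (zero {n} Fin.<_) (sym (lookup-map b suc r)) z<s
     ; (suc a) (suc b) (s≤s a<b) →
         subst₂ Fin._<_ (sym (lookup-map a suc r)) (sym (lookup-map b suc r)) (s≤s (r↑ a b a<b)) }) ,
  (λ { {zero} _ → here refl ; {suc i} Pi → there (Vec.∈-map⁺ suc (complete Pi)) }) ,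
  λ { zero → P0 ; (suc b) → subst P (sym (lookup-map b suc r)) (sound b) }

-- Occurrences

letter-injective : ∀ π → Injective _≡_ _≡_ (letter π)
letter-injective (perm _ w d) = lookup-injective (recompute (unique? w) d) _ _

size>0 : ∀ π → 0 ℕ.< size π
size>0 (perm n _ _) = ℕ.>-nonZero⁻¹ n

≼⇒size≤ : ∀ σ π → σ ≼ π → size σ ℕ.≤ size π
≼⇒size≤ σ π (p , p↑ , _) = Fin.injective⇒≤ (increasing-injective p p↑)

-- Containment of distinct permutations strictly raises the size, which the opposite containment
-- forbids.
≼-antisym : ∀ σ π → σ ≼ π → π ≼ σ → σ ≡ π
≼-antisym σ π σ≼π π≼σ = decidable-stable (σ ≟ π) λ σ≢π →
  ℕ.<⇒≱ (≺⇒size< {σ} {π} (σ≼π , σ≢π)) (≼⇒size≤ π σ π≼σ)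

module _ (σ τ π : Perm) where

  occurrence-∘ : ∀ q p → Occurrence σ τ q → Occurrence τ π p → Occurrence σ π (Vec.map (lookup p) q)
  occurrence-∘ q p (q↑ , σ⇔τ) (p↑ , τ⇔π) =
    (λ a b a<b → subst₂ Fin._<_ (sym (lookup-map a _ q)) (sym (lookup-map b _ q)) (p↑ _ _ (q↑ a b a<b))) ,
    λ a b → subst₂ (λ x y → letter σ a Fin.< letter σ b ⇔ letter π x Fin.< letter π y)
      (sym (lookup-map a _ q)) (sym (lookup-map b _ q)) (⇔-trans (σ⇔τ a b) (τ⇔π _ _))

  ≼-trans : σ ≼ τ → τ ≼ π → σ ≼ π
  ≼-trans (q , σ≼τ) (p , τ≼π) = Vec.map (lookup p) q , occurrence-∘ q p σ≼τ τ≼π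

  -- The indices in `p` of the entries of `q` form the occurrence: both permutations inherit their
  -- order from `π`.
  occurrence-⊆⇒≼ : ∀ q p → Occurrence σ π q → Occurrence τ π p → q ⊆ p → σ ≼ τ
  occurrence-⊆⇒≼ q p (q↑ , σ⇔π) (p↑ , τ⇔π) q⊆p = tabulate f ,
    (λ a b a<b → subst₂ Fin._<_ (sym (lookup∘tabulate f a)) (sym (lookup∘tabulate f b))
      (increasing-reflects p p↑ (subst₂ Fin._<_ (q≡p∘f a) (q≡p∘f b) (q↑ a b a<b)))) ,
    λ a b → subst₂ (λ x y → letter σ a Fin.< letter σ b ⇔ letter τ x Fin.< letter τ y)
      (sym (lookup∘tabulate f a)) (sym (lookup∘tabulate f b))
      (⇔-trans
        (subst₂ (λ x y → letter σ a Fin.< letter σ b ⇔ letter π x Fin.< letter π y) (q≡p∘f a) (q≡p∘f b) (σ⇔π a b))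
        (⇔-sym (τ⇔π (f a) (f b))))
    where
    f : Fin (size σ) → Fin (size τ)
    f a = index (q⊆p a)
    q≡p∘f : ∀ a → lookup q a ≡ lookup p (f a)
    q≡p∘f a = lookup-index (q⊆p a)

-- Standardisation

total : (Fin n → ℕ) → ℕ
total f = Vec.sum (tabulate f)

total-mono-≤ : {f g : Fin n → ℕ} → (∀ i → f i ℕ.≤ g i) → total f ℕ.≤ total g
total-mono-≤ {zero}  f≤g = z≤n
total-mono-≤ {suc n} f≤g = ℕ.+-mono-≤ (f≤g zero) (total-mono-≤ (f≤g ∘ suc))

total-mono-< : {f g : Fin n → ℕ} → (∀ i → f i ℕ.≤ g i) → ∀ i → f i ℕ.< g i → total f ℕ.< total g
total-mono-< f≤g zero    fi<gi = ℕ.+-mono-<-≤ fi<gi (total-mono-≤ (f≤g ∘ suc))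
total-mono-< f≤g (suc i) fi<gi = ℕ.+-mono-≤-< (f≤g zero) (total-mono-< (f≤g ∘ suc) i fi<gi)

total-1 : ∀ n → total {n} (λ _ → 1) ≡ n
total-1 zero    = refl
total-1 (suc n) = cong suc (total-1 n)

module _ {v : Fin k → Fin n} (v-injective : Injective _≡_ _≡_ v) where

  private
    below : Fin k → Fin k → ℕ
    below a b = if does (v b Fin.<? v a) then 1 else 0

    below≤1 : ∀ a b → below a b ℕ.≤ 1
    below≤1 a b with does (v b Fin.<? v a)
    ... | true  = ℕ.≤-refl
    ... | false = z≤n

    below-< : ∀ {a b} → v b Fin.< v a → below a b ≡ 1
    below-< {a} {b} vb<va = cong (if_then 1 else 0) (dec-true (v b Fin.<? v a) vb<va)

    below-≮ : ∀ {a b} → ¬ v b Fin.< v a → below a b ≡ 0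
    below-≮ {a} {b} vb≮va = cong (if_then 1 else 0) (dec-false (v b Fin.<? v a) vb≮va)

    below-self<1 : ∀ a → below a a ℕ.< 1
    below-self<1 a = ℕ.≤-reflexive (cong suc (below-≮ {a} {a} (ℕ.<-irrefl refl)))

    below-mono : ∀ {a b} → v a Fin.< v b → ∀ c → below a c ℕ.≤ below b c
    below-mono {a} {b} va<vb c = helper (v c Fin.<? v a)
      where
      helper : Dec (v c Fin.< v a) → below a c ℕ.≤ below b c
      helper (yes vc<va) = subst (below a c ℕ.≤_) (sym (below-< (ℕ.<-trans vc<va va<vb))) (below≤1 a c)
      helper (no  vc≮va) = subst (ℕ._≤ below b c) (sym (below-≮ vc≮va)) z≤n

  -- The number of `b` with `v b` below `v a`. It is less than `k` because `a` does not count
  -- itself.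
  rank : Fin k → Fin k
  rank a = fromℕ< (subst (total (below a) ℕ.<_) (total-1 k) (total-mono-< (below≤1 a) a (below-self<1 a)))

  -- Whatever is below `a` is below `b`, and `a` itself is counted only for `b`.
  rank-< : ∀ {a b} → v a Fin.< v b → rank a Fin.< rank b
  rank-< {a} {b} va<vb = subst₂ ℕ._<_ (sym (Fin.toℕ-fromℕ< _)) (sym (Fin.toℕ-fromℕ< _))
    (total-mono-< (below-mono va<vb) a (subst (below a a ℕ.<_) (sym (below-< va<vb)) (below-self<1 a)))

  rank-<⁻ : ∀ {a b} → rank a Fin.< rank b → v a Fin.< v b
  rank-<⁻ {a} {b} ra<rb with Fin.<-cmp (v a) (v b)
  ... | tri< va<vb _ _ = va<vb
  ... | tri≈ _ va≡vb _ = contradiction ra<rb (ℕ.<-irrefl (cong (toℕ ∘ rank) (v-injective va≡vb)))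
  ... | tri> _ _ vb<va = contradiction ra<rb (ℕ.<-asym (rank-< vb<va))

  rank-injective : Injective _≡_ _≡_ rank
  rank-injective {a} {b} eq with Fin.<-cmp (v a) (v b)
  ... | tri< va<vb _ _ = contradiction (rank-< va<vb) (ℕ.<-irrefl (cong toℕ eq))
  ... | tri≈ _ va≡vb _ = v-injective va≡vb
  ... | tri> _ _ vb<va = contradiction (rank-< vb<va) (ℕ.<-irrefl (cong toℕ (sym eq)))

module _ (π : Perm) .⦃ _ : NonZero k ⦄ (r : Vec (Fin (size π)) k) (r↑ : Increasing r) where

  private
    v-injective : Injective _≡_ _≡_ (λ a → letter π (lookup r a))
    v-injective = increasing-injective r r↑ ∘ letter-injective π

  patternAt : Perm
  patternAt = perm k (tabulate (rank v-injective)) (tabulate⁺ (rank-injective v-injective))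

  patternAt-occurrence : Occurrence patternAt π r
  patternAt-occurrence = r↑ , λ a b →
    subst₂ (λ x y → x Fin.< y ⇔ letter π (lookup r a) Fin.< letter π (lookup r b))
      (sym (lookup∘tabulate _ a)) (sym (lookup∘tabulate _ b))
      (mk⇔ (rank-<⁻ v-injective) (rank-< v-injective))

-- Embeddings

module _ (π : Perm) (p : Vec (Fin (size π)) k) where

  open Membership (Fin._≟_ {size π}) using (_∈?_)

  embed-∈ : ∀ {i} → i ∈ p → lookup (embed π p) i ≡ suc (letter π i)
  embed-∈ {i} i∈p = trans (lookup∘tabulate _ i) (cong (if_then suc (letter π i) else zero) (dec-true (i ∈? p) i∈p))

  embed-∉ : ∀ {i} → i ∉ p → lookup (embed π p) i ≡ zero
  embed-∉ {i} i∉p = trans (lookup∘tabulate _ i) (cong (if_then suc (letter π i) else zero) (dec-false (i ∈? p) i∉p))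

  embed-≡zero : ∀ {i} → lookup (embed π p) i ≡ zero → i ∉ p
  embed-≡zero eq i∈p with () ← trans (sym eq) (embed-∈ i∈p)

  embed-≢zero : ∀ {i} → lookup (embed π p) i ≢ zero → i ∈ p
  embed-≢zero {i} ≢zero = decidable-stable (i ∈? p) (≢zero ∘ embed-∉)

lookup-ext : {A : Set} {u v : Vec A n} → (∀ i → lookup u i ≡ lookup v i) → u ≡ v
lookup-ext {u = u} {v} eq = trans (sym (tabulate∘lookup u)) (trans (tabulate-cong eq) (tabulate∘lookup v))

-- Consecutive positions within an adjacency

Consecutive : ℕ → ℕ → Set
Consecutive x y = y ≡ suc x ⊎ x ≡ suc y

-- Nothing lies strictly between consecutive values, so a third value compares alike with both.
consecutive-<ˡ : ∀ {x y z} → Consecutive x y → z ≢ x → z ≢ y → z ℕ.< x → z ℕ.< y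
consecutive-<ˡ (inj₁ refl) z≢x z≢y z<x = ℕ.m<n⇒m<1+n z<x
consecutive-<ˡ (inj₂ refl) z≢x z≢y z<x = ℕ.≤∧≢⇒< (ℕ.s≤s⁻¹ z<x) z≢y

consecutive-<ʳ : ∀ {x y z} → Consecutive x y → z ≢ x → z ≢ y → x ℕ.< z → y ℕ.< z
consecutive-<ʳ (inj₁ refl) z≢x z≢y x<z = ℕ.≤∧≢⇒< x<z (z≢y ∘ sym)
consecutive-<ʳ (inj₂ refl) z≢x z≢y x<z = ℕ.<-trans (ℕ.n<1+n _) x<z

shift : (i j x : Fin n) → Fin n
shift i j x with x Fin.≟ i
... | yes _ = j
... | no  _ = x

≤-shift : ∀ {i j : Fin n} → i Fin.≤ j → ∀ x → x Fin.≤ shift i j x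
≤-shift {i = i} i≤j x with x Fin.≟ i
... | yes refl = i≤j
... | no  _    = ℕ.≤-refl

shift-self : ∀ (i j : Fin n) → shift i j i ≡ j
shift-self i j with i Fin.≟ i
... | yes _  = refl
... | no i≢i = contradiction refl i≢i

-- As `j` comes right after `i`, an entry beyond `i` other than `j` is already beyond `j`.
shift-< : ∀ {i j x y : Fin n} → toℕ j ≡ suc (toℕ i) → y ≢ j → x Fin.< y → shift i j x Fin.< shift i j y
shift-< {i = i} {j} {x} {y} j≡1+i y≢j x<y with x Fin.≟ i | y Fin.≟ i
... | yes refl | yes refl = contradiction x<y (ℕ.<-irrefl refl)
... | yes refl | no _     = ℕ.≤∧≢⇒< (subst (ℕ._≤ toℕ y) (sym j≡1+i) x<y) (y≢j ∘ sym ∘ Fin.toℕ-injective)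
... | no _     | yes refl = subst (toℕ x ℕ.<_) (sym j≡1+i) (ℕ.m<n⇒m<1+n x<y)
... | no _     | no _     = x<y

predecessor : (a x : Fin n) → a Fin.< x → ∃ λ (j : Fin n) → toℕ x ≡ suc (toℕ j)
predecessor a (suc y) _ = Fin.inject₁ y , cong suc (sym (Fin.toℕ-inject₁ y))

module _ (π : Perm) where

  open Membership (Fin._≟_ {size π}) using (_∈?_)

  -- The local form of adjacencies: a position lies in a tail exactly when some step leads into it.
  -- Normality and being rightmost thereby reduce to neighbouring positions.
  Step : (i j : Fin (size π)) → Set
  Step i j = toℕ j ≡ suc (toℕ i) × Run π i j

  step? : ∀ i j → Dec (Step i j)
  step? i j = toℕ j ℕ.≟ suc (toℕ i) ×-dec run? π i j

  step⇒< : ∀ {i j} → Step i j → i Fin.< j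
  step⇒< (j≡1+i , _) = ℕ.≤-reflexive (sym j≡1+i)

  step-consecutive : ∀ {i j} → Step i j → Consecutive (toℕ (letter π i)) (toℕ (letter π j))
  step-consecutive {i} {j} (j≡1+i , _ , run) =
    Sum.map (λ asc → asc i j ℕ.≤-refl ℕ.≤-refl j≡1+i) (λ desc → desc i j ℕ.≤-refl ℕ.≤-refl j≡1+i) run

  subrun : ∀ {a b c d} → Run π a b → a Fin.≤ c → c Fin.≤ d → d Fin.≤ b → Run π c d
  subrun (_ , run) a≤c c≤d d≤b = c≤d , Sum.map
    (λ asc  i j c≤i j≤d → asc  i j (ℕ.≤-trans a≤c c≤i) (ℕ.≤-trans j≤d d≤b))
    (λ desc i j c≤i j≤d → desc i j (ℕ.≤-trans a≤c c≤i) (ℕ.≤-trans j≤d d≤b)) run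

  -- A run is enlarged until it is maximal. The measure counts the positions before `c` and those
  -- from `d` on, and drops whenever either end moves outwards.
  run⇒adjacency : ∀ c d → Run π c d → ∃₂ λ a b → Adjacency π a b × a Fin.≤ c × d Fin.≤ b
  run⇒adjacency c d = extend c d (<-wellFounded _)
    where
    extend : ∀ c d → Acc ℕ._<_ (toℕ c ℕ.+ (size π ℕ.∸ toℕ d)) → Run π c d →
             ∃₂ λ a b → Adjacency π a b × a Fin.≤ c × d Fin.≤ b
    extend c d (acc rec) run with (Fin.any? λ a → Fin.any? λ b →
      run? π a b ×-dec a Fin.≤? c ×-dec d Fin.≤? b ×-dec ¬? (a Fin.≟ c ×-dec b Fin.≟ d))
    ... | no maximal = c , d , (run , λ a b run′ a≤c d≤b →
            decidable-stable (a Fin.≟ c ×-dec b Fin.≟ d) λ ≢ → maximal (a , b , run′ , a≤c , d≤b , ≢)) ,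
            ℕ.≤-refl , ℕ.≤-refl
    ... | yes (a , b , run′ , a≤c , d≤b , ≢) =
            let a′ , b′ , adj , a′≤a , b≤b′ = extend a b (rec smaller) run′
            in a′ , b′ , adj , ℕ.≤-trans a′≤a a≤c , ℕ.≤-trans d≤b b≤b′
      where
      smaller : toℕ a ℕ.+ (size π ℕ.∸ toℕ b) ℕ.< toℕ c ℕ.+ (size π ℕ.∸ toℕ d)
      smaller with a Fin.≟ c
      ... | no a≢c   = ℕ.+-mono-<-≤ (ℕ.≤∧≢⇒< a≤c (a≢c ∘ Fin.toℕ-injective)) (ℕ.∸-monoʳ-≤ (size π) d≤b)
      ... | yes refl = ℕ.+-monoʳ-< (toℕ a) (ℕ.∸-monoʳ-<
              (ℕ.≤∧≢⇒< d≤b (λ d≡b → ≢ (refl , sym (Fin.toℕ-injective d≡b)))) (ℕ.<⇒≤ (Fin.toℕ<n b)))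

  normal-step : ∀ η → Normal π η → ∀ {i j} → Step i j → lookup η j ≢ zero
  normal-step η normal {i} {j} step with a , b , adj , a≤i , j≤b ← run⇒adjacency i j (proj₂ step) =
    normal a b adj j (ℕ.≤-<-trans a≤i (step⇒< step)) j≤b

  rightmost-step : ∀ η → Rightmost π η → ∀ {i j} → Step i j → lookup η i ≢ zero → lookup η j ≢ zero
  rightmost-step η rightmost {i} {j} step with a , b , adj , a≤i , j≤b ← run⇒adjacency i j (proj₂ step) =
    rightmost a b adj i j a≤i (step⇒< step) j≤b

  adjacency-step : ∀ {a b} → Adjacency π a b → ∀ {i j} → toℕ j ≡ suc (toℕ i) → a Fin.≤ i → j Fin.≤ b → Step i j
  adjacency-step (run , _) j≡1+i a≤i j≤b = j≡1+i , subrun run a≤i (ℕ.<⇒≤ (ℕ.≤-reflexive (sym j≡1+i))) j≤b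

  tail-step : ∀ {a b} → Adjacency π a b → ∀ {x} → a Fin.< x → x Fin.≤ b → ∃ λ j → Step j x
  tail-step {a} adj {x} a<x x≤b with j , x≡1+j ← predecessor a x a<x =
    j , adjacency-step adj x≡1+j (ℕ.s≤s⁻¹ (subst (toℕ a ℕ.<_) x≡1+j a<x)) x≤b

  StepClosed : Vec (Fin (size π)) k → Set
  StepClosed p = ∀ {i j} → Step i j → i ∈ p → j ∈ p

  -- Closure under single steps propagates along the adjacency, by induction on the distance from
  -- `i` to `j`.
  embed-rightmost : (p : Vec (Fin (size π)) k) → StepClosed p → Rightmost π (embed π p)
  embed-rightmost p closed a b adj i j a≤i i<j j≤b ηi≢0 ηj≡0 = embed-≡zero π p ηj≡0
    (walk (toℕ j ℕ.∸ toℕ i) i (sym (ℕ.m∸n+n≡m (ℕ.<⇒≤ i<j))) a≤i (embed-≢zero π p ηi≢0))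
    where
    walk : ∀ d i → toℕ j ≡ d ℕ.+ toℕ i → a Fin.≤ i → i ∈ p → j ∈ p
    walk zero    i j≡i     a≤i i∈p = subst (_∈ p) (sym (Fin.toℕ-injective j≡i)) i∈p
    walk (suc d) i j≡1+d+i a≤i i∈p = walk d i⁺ j≡d+i⁺ (ℕ.≤-trans a≤i (ℕ.<⇒≤ (ℕ.≤-reflexive (sym i⁺≡1+i))))
      (closed (adjacency-step adj i⁺≡1+i a≤i (ℕ.≤-trans i⁺≤j j≤b)) i∈p)
      where
      i<j′ : toℕ i ℕ.< toℕ j
      i<j′ = subst (toℕ i ℕ.<_) (sym j≡1+d+i) (s≤s (ℕ.m≤n+m (toℕ i) d))
      i⁺ : Fin (size π)
      i⁺ = fromℕ< (ℕ.≤-<-trans i<j′ (Fin.toℕ<n j))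
      i⁺≡1+i : toℕ i⁺ ≡ suc (toℕ i)
      i⁺≡1+i = Fin.toℕ-fromℕ< _
      i⁺≤j : i⁺ Fin.≤ j
      i⁺≤j = subst (ℕ._≤ toℕ j) (sym i⁺≡1+i) i<j′
      j≡d+i⁺ : toℕ j ≡ d ℕ.+ toℕ i⁺
      j≡d+i⁺ = trans j≡1+d+i (trans (sym (ℕ.+-suc d (toℕ i))) (cong (d ℕ.+_) (sym i⁺≡1+i)))

  -- The letters at `i` and `j` are consecutive values, so replacing one by the other changes no
  -- comparison with a third letter.
  shift-letter : ∀ {i j x y} → Step i j → x ≢ j → y ≢ j →
    letter π x Fin.< letter π y ⇔ letter π (shift i j x) Fin.< letter π (shift i j y)
  shift-letter {i} {j} {x} {y} step x≢j y≢j with x Fin.≟ i | y Fin.≟ i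
  ... | yes refl | yes refl = mk⇔ (λ < → contradiction < (ℕ.<-irrefl refl)) (λ < → contradiction < (ℕ.<-irrefl refl))
  ... | yes refl | no y≢i   = mk⇔
    (consecutive-<ʳ (step-consecutive step) (apart y≢i) (apart y≢j))
    (consecutive-<ʳ (Sum.swap (step-consecutive step)) (apart y≢j) (apart y≢i))
    where
    apart : ∀ {i j} → i ≢ j → toℕ (letter π i) ≢ toℕ (letter π j)
    apart i≢j = i≢j ∘ letter-injective π ∘ Fin.toℕ-injective
  ... | no x≢i   | yes refl = mk⇔
    (consecutive-<ˡ (step-consecutive step) (apart x≢i) (apart x≢j))
    (consecutive-<ˡ (Sum.swap (step-consecutive step)) (apart x≢j) (apart x≢i))
    where
    apart : ∀ {i j} → i ≢ j → toℕ (letter π i) ≢ toℕ (letter π j)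
    apart i≢j = i≢j ∘ letter-injective π ∘ Fin.toℕ-injective
  ... | no _     | no _     = mk⇔ id id

  Supported : Seq π → Vec (Fin (size π)) k → Set
  Supported η p = ∀ a → lookup η (lookup p a) ≢ zero

  module _ (σ : Perm) where

    shift-occurrence : ∀ {i j} → Step i j → ∀ {p} → j ∉ p → Occurrence σ π p → Occurrence σ π (Vec.map (shift i j) p)
    shift-occurrence {i} {j} step {p} j∉p (p↑ , σ⇔π) =
      (λ a b a<b → subst₂ Fin._<_ (sym (lookup-map a _ p)) (sym (lookup-map b _ p))
        (shift-< (proj₁ step) (p≢j b) (p↑ a b a<b))) ,
      λ a b → subst₂ (λ x y → letter σ a Fin.< letter σ b ⇔ letter π x Fin.< letter π y)
        (sym (lookup-map a _ p)) (sym (lookup-map b _ p))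
        (⇔-trans (σ⇔π a b) (shift-letter step (p≢j a) (p≢j b)))
      where
      p≢j : ∀ a → lookup p a ≢ j
      p≢j a refl = j∉p (∈-lookup a p)

    -- Moving a letter one place to the right inside an adjacency keeps an occurrence an
    -- occurrence, and keeps it inside a normal η, which contains every tail.
    rightmost-occurrence : ∀ η → Normal π η → ∀ p → Occurrence σ π p → Supported η p →
      ∃ λ q → Occurrence σ π q × Supported η q × StepClosed q
    rightmost-occurrence η normal p = move p (<-wellFounded _)
      where
      distance : Fin (size π) → ℕ
      distance x = size π ℕ.∸ toℕ x
      move : ∀ p → Acc ℕ._<_ (total (λ a → distance (lookup p a))) → Occurrence σ π p → Supported η p →
             ∃ λ q → Occurrence σ π q × Supported η q × StepClosed q
      move p (acc rec) occ supp with (Fin.any? λ i → Fin.any? λ j → step? i j ×-dec i ∈? p ×-dec ¬? (j ∈? p))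
      ... | no stuck = p , occ , supp , λ {i} {j} step i∈p →
              decidable-stable (j ∈? p) λ j∉p → stuck (i , j , step , i∈p , j∉p)
      ... | yes (i , j , step , i∈p , j∉p) = move p′ (rec smaller) (shift-occurrence step j∉p occ) supp′
        where
        p′ = Vec.map (shift i j) p
        p≤p′ : ∀ a → lookup p a Fin.≤ lookup p′ a
        p≤p′ a = subst (lookup p a Fin.≤_) (sym (lookup-map a (shift i j) p)) (≤-shift (ℕ.<⇒≤ (step⇒< step)) (lookup p a))
        p′i≡j : lookup p′ (index i∈p) ≡ j
        p′i≡j = trans (lookup-map (index i∈p) (shift i j) p)
                      (trans (cong (shift i j) (sym (lookup-index i∈p))) (shift-self i j))
        pi<p′i : lookup p (index i∈p) Fin.< lookup p′ (index i∈p)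
        pi<p′i = subst₂ Fin._<_ (lookup-index i∈p) (sym p′i≡j) (step⇒< step)
        -- The measure is the total distance of the entries from the right end: no entry moves left,
        -- and the one at `i` moves right.
        smaller : total (λ a → distance (lookup p′ a)) ℕ.< total (λ a → distance (lookup p a))
        smaller = total-mono-< (λ a → ℕ.∸-monoʳ-≤ (size π) (p≤p′ a)) (index i∈p)
                               (ℕ.∸-monoʳ-< pi<p′i (ℕ.<⇒≤ (Fin.toℕ<n (lookup p′ (index i∈p)))))
        supp′ : Supported η p′
        supp′ a = subst (λ x → lookup η x ≢ zero) (sym (lookup-map a (shift i j) p)) (nonzero (lookup p a) (supp a))
          where
          nonzero : ∀ x → lookup η x ≢ zero → lookup η (shift i j x) ≢ zero
          nonzero x ηx≢0 with x Fin.≟ i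
          ... | yes _ = normal-step η normal step
          ... | no  _ = ηx≢0

    -- A rightmost embedding vanishing in a tail also vanishes one place to the left.
    singleBlock-head : SingleBlock σ π → ∃ λ i → (∀ j → ¬ Step j i) × (∀ η → Ê σ π η → lookup η i ≡ zero)
    singleBlock-head (i , block) = leftwards (toℕ i) i refl block
      where
      leftwards : ∀ d i → toℕ i ≡ d → (∀ η → Ê σ π η → lookup η i ≡ zero) →
                  ∃ λ i → (∀ j → ¬ Step j i) × (∀ η → Ê σ π η → lookup η i ≡ zero)
      leftwards d i i≡d block with Fin.any? (λ j → step? j i)
      ... | no head = i , (λ j step → head (j , step)) , block
      leftwards zero    i i≡d block | yes (j , i≡1+j , _) with () ← trans (sym i≡d) i≡1+j
      leftwards (suc d) i i≡d block | yes (j , step@(i≡1+j , _)) =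
        leftwards d j (ℕ.suc-injective (trans (sym i≡1+j) i≡d)) λ η η∈Ê@(_ , _ , _ , _ , rightmost) →
          decidable-stable (lookup η j Fin.≟ zero) λ ηj≢0 →
            rightmost-step η rightmost step ηj≢0 (block η η∈Ê)

-- Toggling an entry of an embedding

-- A nonzero entry other than `suc x` cannot stand at this position of an embedding. Fixing it makes
-- the toggle an involution on all sequences, so no subtype of embeddings is needed.
toggle : ∀ {n} → Fin n → Fin (suc n) → Fin (suc n)
toggle x zero    = suc x
toggle x (suc y) with y Fin.≟ x
... | yes _ = zero
... | no  _ = suc y

toggle-suc : ∀ {n} (x : Fin n) → toggle x (suc x) ≡ zero
toggle-suc x with x Fin.≟ x
... | yes _  = refl
... | no x≢x = contradiction refl x≢x

toggle-involutive : ∀ {n} (x : Fin n) y → toggle x (toggle x y) ≡ y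
toggle-involutive x zero    = toggle-suc x
toggle-involutive x (suc y) with y Fin.≟ x
... | yes refl = refl
... | no y≢x with y Fin.≟ x
...   | yes y≡x = contradiction y≡x y≢x
...   | no  _   = refl

∸-suc : ∀ {m n} → m ℕ.< n → n ∸ m ≡ suc (n ∸ suc m)
∸-suc {zero}  {suc n} _          = refl
∸-suc {suc m} {suc n} (ℕ.s≤s m<n) = ∸-suc m<n

module _ (π : Perm) where

  open Membership (Fin._≟_ {size π}) using (_∈?_)

  toggleAt : Fin (size π) → Seq π → Seq π
  toggleAt i η = updateAt η i (toggle (letter π i))

  toggleAt-involutive : ∀ i η → toggleAt i (toggleAt i η) ≡ η
  toggleAt-involutive i η = trans (updateAt-updateAt i η) (updateAt-id-local i η (toggle-involutive _ _))

  -- The pairs of `τ` and `η` that the weight sum at `ζ` counts with sign.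
  Marked : Perm → Perm → Seq π → Set
  Marked ζ τ η = ζ ≼ τ × IsEmbedding τ π η × Normal π η

  -- Equal embeddings have the same nonzero positions, so each pattern occurs in the other.
  embedding-unique : ∀ σ τ {η} → IsEmbedding σ π η → IsEmbedding τ π η → σ ≡ τ
  embedding-unique σ τ (p , occp , eqp) (q , occq , eqq) = ≼-antisym σ τ
    (occurrence-⊆⇒≼ σ τ π p q occp occq (⊆-of p q (trans (sym eqp) eqq)))
    (occurrence-⊆⇒≼ τ σ π q p occq occp (⊆-of q p (trans (sym eqq) eqp)))
    where
    ⊆-of : ∀ {k l} (p : Vec (Fin (size π)) k) (q : Vec (Fin (size π)) l) → embed π p ≡ embed π q → p ⊆ q
    ⊆-of p q eq a = embed-≢zero π q λ q∌ → embed-≡zero π p (trans (cong (λ v → lookup v (lookup p a)) eq) q∌) (∈-lookup a p)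

  -- The position `i` is chosen before `τ` and `η`, since one involution has to serve all sequences.
  -- The new pattern `τ′` is the standardisation of the letters at the nonzero positions `r` of the
  -- toggled sequence.
  toggle-marked : ∀ ζ → SingleBlock ζ π → ∃ λ i → ∀ τ η → Marked ζ τ η →
    ∃ λ τ′ → Marked ζ τ′ (toggleAt i η) × (size τ′ ≡ suc (size τ) ⊎ size τ ≡ suc (size τ′))
  toggle-marked ζ block with i , head , vanish ← singleBlock-head π ζ block = i , toggled
    where
    toggled : ∀ τ η → Marked ζ τ η →
      ∃ λ τ′ → Marked ζ τ′ (toggleAt i η) × (size τ′ ≡ suc (size τ) ⊎ size τ ≡ suc (size τ′))
    toggled τ η ((q₀ , occ₀) , (p , occ@(p↑ , _) , refl) , normal)
      -- The occurrence of `ζ` in `τ`, read in `π` through `p`, lies on the support of `η`; pushing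
      -- it to the right gives `q`.
      with q , occq , supp , closed ← rightmost-occurrence π ζ η normal (Vec.map (lookup p) q₀)
             (occurrence-∘ ζ τ π q₀ p occ₀ occ)
             (λ a ≡0 → embed-≡zero π p ≡0 (subst (_∈ p) (sym (lookup-map a (lookup p) q₀)) (∈-lookup _ p)))
      with k , r , r↑ , complete , sound ← enumerate (λ x → ¬? (lookup (toggleAt i η) x Fin.≟ zero))
      = patternAt π r r↑ ,
        (occurrence-⊆⇒≼ ζ (patternAt π r r↑) π q r occq (patternAt-occurrence π r r↑) q⊆r ,
         (r , patternAt-occurrence π r r↑ , lookup-ext η′≡embed) , normal′) ,
        sizes
      where
      η′ = toggleAt i η

      i∉q : i ∉ q
      -- Being step-closed, `q` gives the rightmost member of its own class, so the property of `i`
      -- applies to it.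
      i∉q = embed-≡zero π q (vanish (embed π q)
        (embed π q , (q , occq , refl) , (q , occq , refl) , (λ _ _ _ → refl) , embed-rightmost π q closed))

      away : ∀ {x} → x ≢ i → lookup η′ x ≡ lookup η x
      away {x} x≢i = lookup∘updateAt′ x i x≢i η

      at-i : lookup η′ i ≡ toggle (letter π i) (lookup η i)
      at-i = lookup∘updateAt i η

      q⊆r : q ⊆ r
      q⊆r a = complete λ ≡0 → supp a (trans (sym (away λ { refl → i∉q (∈-lookup a q) })) ≡0)

      -- Deleting the letter at `i` cannot empty the sequence, because the letters of the nonempty
      -- `ζ` at `q` remain.
      instance
        k≢0 : NonZero k
        k≢0 = ℕ.>-nonZero (ℕ.≤-trans (size>0 ζ)
          (injective-⊆⇒≤ q r (increasing-injective q (proj₁ occq)) q⊆r))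

      p⇒r : ∀ {x} → x ≢ i → x ∈ p → x ∈ r
      p⇒r x≢i x∈p = complete λ ≡0 → embed-≡zero π p (trans (sym (away x≢i)) ≡0) x∈p

      r⇒p : ∀ {x} → x ≢ i → x ∈ r → x ∈ p
      r⇒p {x} x≢i x∈r = embed-≢zero π p λ ≡0 →
        subst (λ y → lookup η′ y ≢ zero) (sym (lookup-index x∈r)) (sound (index x∈r)) (trans (away x≢i) ≡0)

      toggle-p : i ∈ p → lookup η′ i ≡ zero
      toggle-p i∈p = trans at-i (trans (cong (toggle (letter π i)) (embed-∈ π p i∈p)) (toggle-suc (letter π i)))

      toggle-¬p : i ∉ p → lookup η′ i ≡ suc (letter π i)
      toggle-¬p i∉p = trans at-i (cong (toggle (letter π i)) (embed-∉ π p i∉p))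

      valid : ∀ x → lookup η′ x ≢ zero → lookup η′ x ≡ suc (letter π x)
      valid x ≢0 with x Fin.≟ i | x ∈? p
      ... | yes refl | yes i∈p = contradiction (toggle-p i∈p) ≢0
      ... | yes refl | no  i∉p = toggle-¬p i∉p
      ... | no  x≢i  | yes x∈p = trans (away x≢i) (embed-∈ π p x∈p)
      ... | no  x≢i  | no  x∉p = contradiction (trans (away x≢i) (embed-∉ π p x∉p)) ≢0

      η′≡embed : ∀ x → lookup η′ x ≡ lookup (embed π r) x
      η′≡embed x with lookup η′ x Fin.≟ zero
      ... | yes ≡0 = trans ≡0 (sym (embed-∉ π r λ x∈r →
              subst (λ y → lookup η′ y ≢ zero) (sym (lookup-index x∈r)) (sound (index x∈r)) ≡0))
      ... | no  ≢0 = trans (valid x ≢0) (sym (embed-∈ π r (complete ≢0)))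

      normal′ : Normal π η′
      -- A step leads into every tail position and none into `i`, so the toggle leaves the tails
      -- alone.
      normal′ a b adj x a<x x≤b ≡0 with j , step ← tail-step π {b = b} adj a<x x≤b =
        normal a b adj x a<x x≤b (trans (sym (away λ { refl → head j step })) ≡0)

      sizes : k ≡ suc (size τ) ⊎ size τ ≡ suc k
      sizes with i ∈? p
      ... | no  i∉p = inj₁ (length-insert p r p↑ r↑ i∉p i∈r (λ a → p⇒r (λ { refl → i∉p (∈-lookup a p) }) (∈-lookup a p)) split)
        where
        i∈r : i ∈ r
        i∈r = complete λ ≡0 → contradiction (trans (sym (toggle-¬p i∉p)) ≡0) λ ()
        split : ∀ b → lookup r b ≡ i ⊎ lookup r b ∈ p
        split b with lookup r b Fin.≟ i
        ... | yes ≡i = inj₁ ≡i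
        ... | no  ≢i = inj₂ (r⇒p ≢i (∈-lookup b r))
      ... | yes i∈p = inj₂ (length-insert r p r↑ p↑ i∉r i∈p (λ a → r⇒p (λ { refl → i∉r (∈-lookup a r) }) (∈-lookup a r)) split)
        where
        i∉r : i ∉ r
        i∉r i∈r = subst (λ y → lookup η′ y ≢ zero) (sym (lookup-index i∈r)) (sound (index i∈r)) (toggle-p i∈p)
        split : ∀ b → lookup p b ≡ i ⊎ lookup p b ∈ r
        split b with lookup p b Fin.≟ i
        ... | yes ≡i = inj₁ ≡i
        ... | no  ≢i = inj₂ (p⇒r ≢i (∈-lookup b p))

  -- Signed weights and their cancellation

  sign : Perm → ℤ
  sign τ = -1ℤ ^ (size π ∸ size τ)

  -- The subtraction is truncated; `τ ≼ π` puts `size σ` below `size π`, so the exponents really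
  -- differ by one.
  sign-suc : ∀ σ τ → τ ≼ π → size τ ≡ suc (size σ) → sign τ ≡ - sign σ
  sign-suc σ τ τ≼π eq = begin
    sign τ           ≡⟨ ℤ.neg-involutive (sign τ) ⟨
    - (- sign τ)     ≡⟨ cong -_ (ℤ.-1*i≡-i (sign τ)) ⟨
    - (-1ℤ * sign τ) ≡⟨ cong (λ e → - (-1ℤ ^ e)) (trans (cong (λ s → suc (size π ∸ s)) eq) (sym (∸-suc σ<π))) ⟩
    - sign σ         ∎
    where
    open ≡-Reasoning
    σ<π : size σ ℕ.< size π
    σ<π = subst (ℕ._≤ size π) eq (≼⇒size≤ τ π τ≼π)

  perms : List Perm
  perms = permsUpTo (size π)

  seqs : List (Seq π)
  seqs = words (suc (size π)) (size π)

  abstract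
    normalEmbedding? : ∀ σ η → Dec (IsEmbedding σ π η × Normal π η)
    normalEmbedding? σ η = isEmbedding? σ π η ×-dec normal? π η

    NE-∑ : ∀ τ → + NE τ π ≡ ∑ seqs (λ η → ⟦ normalEmbedding? τ η ⟧)
    NE-∑ τ = length-filter (normalEmbedding? τ) seqs

  weight : Perm → ℤ
  weight τ = sign τ * + NE τ π

  weight≢0 : ∀ τ → weight τ ≢ 0ℤ → τ ≼ π
  weight≢0 τ ≢0 with η , _ , η≢0 ← ∑≢0 seqs _ (λ ≡0 → ≢0 (trans (cong (sign τ *_) (trans (NE-∑ τ) ≡0)) (ℤ.*-zeroʳ (sign τ))))
    with (p , occ , _) , _ ← ⟦⟧≢0 (normalEmbedding? τ η) η≢0 = p , occ

  term : Perm → Perm → Seq π → ℤ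
  term ζ τ η = ⟦ ζ ≼? τ ⟧ * (⟦ normalEmbedding? τ η ⟧ * sign τ)

  -- At most one τ contributes: the pattern of the nonzero letters of η.
  signedMark : Perm → Seq π → ℤ
  signedMark ζ η = ∑ perms (λ τ → term ζ τ η)

  -- Double counting: `NE` is expanded into brackets over all sequences, and the sum is regrouped by
  -- sequence.
  ∑-weight : ∀ ζ → ∑ perms (λ τ → ⟦ ζ ≼? τ ⟧ * weight τ) ≡ ∑ seqs (signedMark ζ)
  ∑-weight ζ = trans (∑-cong perms expand) (∑-swap perms seqs (term ζ))
    where
    open ≡-Reasoning
    expand : ∀ τ → ⟦ ζ ≼? τ ⟧ * weight τ ≡ ∑ seqs (term ζ τ)
    expand τ = begin
      ⟦ ζ ≼? τ ⟧ * weight τ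
        ≡⟨ cong (λ s → ⟦ ζ ≼? τ ⟧ * (sign τ * s)) (NE-∑ τ) ⟩
      ⟦ ζ ≼? τ ⟧ * (sign τ * ∑ seqs (λ η → ⟦ normalEmbedding? τ η ⟧))
        ≡⟨ cong (⟦ ζ ≼? τ ⟧ *_) (∑-*ˡ (sign τ) seqs _) ⟩
      ⟦ ζ ≼? τ ⟧ * ∑ seqs (λ η → sign τ * ⟦ normalEmbedding? τ η ⟧)
        ≡⟨ ∑-*ˡ ⟦ ζ ≼? τ ⟧ seqs _ ⟩
      ∑ seqs (λ η → ⟦ ζ ≼? τ ⟧ * (sign τ * ⟦ normalEmbedding? τ η ⟧))
        ≡⟨ ∑-cong seqs (λ η → cong (⟦ ζ ≼? τ ⟧ *_) (ℤ.*-comm (sign τ) ⟦ normalEmbedding? τ η ⟧)) ⟩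
      ∑ seqs (term ζ τ) ∎

  term≢0 : ∀ ζ τ η → term ζ τ η ≢ 0ℤ → Marked ζ τ η
  term≢0 ζ τ η ≢0 = let ζ≼τ , ≢0′ = ⟦⟧*≢0 (ζ ≼? τ) ≢0 in ζ≼τ , proj₁ (⟦⟧*≢0 (normalEmbedding? τ η) ≢0′)

  term-marked : ∀ ζ τ η → Marked ζ τ η → term ζ τ η ≡ sign τ
  term-marked ζ τ η (ζ≼τ , η∈) = trans (⟦⟧*-true (ζ ≼? τ) ζ≼τ) (⟦⟧*-true (normalEmbedding? τ η) η∈)

  signedMark-marked : ∀ ζ τ η → Marked ζ τ η → signedMark ζ η ≡ sign τ
  signedMark-marked ζ τ η marked@(_ , emb@(p , occ , _) , _) = trans
    (∑-single (λ τ → term ζ τ η) (permsUpTo! (size π)) (∈-permsUpTo⁺ (≼⇒size≤ τ π (p , occ)))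
      (λ {τ′} _ ≢0 → embedding-unique τ′ τ (proj₁ (proj₂ (term≢0 ζ τ′ η ≢0))) emb))
    (term-marked ζ τ η marked)

  signedMark≢0 : ∀ ζ η → signedMark ζ η ≢ 0ℤ → ∃ λ τ → Marked ζ τ η
  signedMark≢0 ζ η ≢0 with τ , _ , ≢0′ ← ∑≢0 perms _ ≢0 = τ , term≢0 ζ τ η ≢0′

  ∑-weight-block : ∀ ζ → SingleBlock ζ π → ∑ perms (λ τ → ⟦ ζ ≼? τ ⟧ * weight τ) ≡ 0ℤ
  ∑-weight-block ζ block = trans (∑-weight ζ) (cancel (toggle-marked ζ block))
    where
    ≼π : ∀ {τ η} → Marked ζ τ η → τ ≼ π
    ≼π (_ , (p , occ , _) , _) = p , occ

    cancel : (∃ λ i → ∀ τ η → Marked ζ τ η →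
      ∃ λ τ′ → Marked ζ τ′ (toggleAt i η) × (size τ′ ≡ suc (size τ) ⊎ size τ ≡ suc (size τ′))) →
      ∑ seqs (signedMark ζ) ≡ 0ℤ
    cancel (i , toggled) =
      ∑-involution {xs = seqs} (words! _ _) ∈-words (toggleAt i) (toggleAt-involutive i) (signedMark ζ) reverses
      where
      reverses-marked : ∀ τ η → Marked ζ τ η → signedMark ζ (toggleAt i η) ≡ - signedMark ζ η
      reverses-marked τ η marked with τ′ , marked′ , sizes ← toggled τ η marked = begin
        signedMark ζ (toggleAt i η) ≡⟨ signedMark-marked ζ τ′ (toggleAt i η) marked′ ⟩
        sign τ′                     ≡⟨ opposite sizes ⟩
        - sign τ                    ≡⟨ cong -_ (signedMark-marked ζ τ η marked) ⟨
        - signedMark ζ η            ∎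
        where
        open ≡-Reasoning
        opposite : size τ′ ≡ suc (size τ) ⊎ size τ ≡ suc (size τ′) → sign τ′ ≡ - sign τ
        opposite (inj₁ eq) = sign-suc τ τ′ (≼π {τ′} {toggleAt i η} marked′) eq
        opposite (inj₂ eq) = trans (sym (ℤ.neg-involutive _)) (cong -_ (sym (sign-suc τ′ τ (≼π {τ} {η} marked) eq)))

      reverses : ∀ η → signedMark ζ (toggleAt i η) ≡ - signedMark ζ η
      reverses η = by-cases (signedMark ζ η ℤ.≟ 0ℤ) (signedMark ζ (toggleAt i η) ℤ.≟ 0ℤ)
        where
        open ≡-Reasoning
        by-cases : Dec (signedMark ζ η ≡ 0ℤ) → Dec (signedMark ζ (toggleAt i η) ≡ 0ℤ) →
                   signedMark ζ (toggleAt i η) ≡ - signedMark ζ η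
        by-cases (yes ≡0) (yes ≡0′) = trans ≡0′ (cong -_ (sym ≡0))
        by-cases (no ≢0)  _         = let τ , marked = signedMark≢0 ζ η ≢0 in reverses-marked τ η marked
        -- Only the toggled sequence is known to be marked, so the marked case is applied to it and
        -- the second toggle undoes the first.
        by-cases (yes _)  (no ≢0′)  = let τ , marked = signedMark≢0 ζ (toggleAt i η) ≢0′ in begin
          signedMark ζ (toggleAt i η)                ≡⟨ ℤ.neg-involutive _ ⟨
          - (- signedMark ζ (toggleAt i η))          ≡⟨ cong -_ (reverses-marked τ (toggleAt i η) marked) ⟨
          - signedMark ζ (toggleAt i (toggleAt i η)) ≡⟨ cong (λ θ → - signedMark ζ θ) (toggleAt-involutive i η) ⟩
          - signedMark ζ η                           ∎

  -- The weight sum at the top element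

  -- A position missing from `p` would give more than `size π` distinct positions.
  embed-self : ∀ {p : Vec (Fin (size π)) (size π)} → Increasing p → ∀ i → i ∈ p
  embed-self {p} p↑ i = decidable-stable (i ∈? p) λ i∉p →
    ℕ.1+n≰n (injective-⊆⇒≤ (i ∷ p) (allFin (size π)) (∷-lookup-injective p i∉p (increasing-injective p p↑)) (λ _ → ∈-allFin⁺ _))

  -- The only embedding of `π` in itself has no zero entry, and so is normal.
  NE-refl : + NE π π ≡ 1ℤ
  NE-refl = begin
    + NE π π                                    ≡⟨ NE-∑ π ⟩
    ∑ seqs (λ η → ⟦ normalEmbedding? π η ⟧)     ≡⟨ ∑-single _ (words! _ _) (∈-words (embed π p₀)) only ⟩
    ⟦ normalEmbedding? π (embed π p₀) ⟧         ≡⟨ ⟦⟧-true (normalEmbedding? π (embed π p₀)) ((p₀ , occ₀ , refl) ,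
                                                     λ _ _ _ i _ _ ≡0 → embed-≡zero π p₀ ≡0 (embed-self (proj₁ occ₀) i)) ⟩
    1ℤ                                          ∎
    where
    open ≡-Reasoning
    p₀ = proj₁ (≼-refl π)
    occ₀ = proj₂ (≼-refl π)
    only : ∀ {η} → _ → ⟦ normalEmbedding? π η ⟧ ≢ 0ℤ → η ≡ embed π p₀
    only {η} _ ≢0 with (p , (p↑ , _) , refl) , _ ← ⟦⟧≢0 (normalEmbedding? π η) ≢0 = lookup-ext λ i →
      trans (embed-∈ π p (embed-self p↑ i)) (sym (embed-∈ π p₀ (embed-self (proj₁ occ₀) i)))

  weight-refl : weight π ≡ 1ℤ
  weight-refl = cong₂ (λ e s → -1ℤ ^ e * s) (ℕ.n∸n≡0 (size π)) NE-refl

  ∑-weight-refl : ∑ perms (λ τ → ⟦ π ≼? τ ⟧ * weight τ) ≡ 1ℤ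
  ∑-weight-refl = trans
    (∑-single (λ τ → ⟦ π ≼? τ ⟧ * weight τ) {xs = perms} (permsUpTo! (size π)) {y = π} (∈-permsUpTo⁺ {π = π} ℕ.≤-refl) only)
    (trans (⟦⟧*-true (π ≼? π) (≼-refl π)) weight-refl)
    where
    only : ∀ {τ} → τ ∈ᴸ perms → ⟦ π ≼? τ ⟧ * weight τ ≢ 0ℤ → τ ≡ π
    only {τ} _ ≢0 = let π≼τ , ≢0′ = ⟦⟧*≢0 (π ≼? τ) ≢0 in ≼-antisym τ π (weight≢0 τ ≢0′) π≼τ

-- The Möbius function

μ≢0 : ∀ a b → μ a b ≢ 0ℤ → a ≼ b
μ≢0 a b ≢0 = decidable-stable (a ≼? b) (λ a⋠b → ≢0 (μ-⋠ {a} {b} a⋠b))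

-- The recursion for `μ` in convolution form. The bound `n` is left free so that one index list
-- serves every `b` below `π`.
∑-μ : ∀ {n} a b → size b ℕ.≤ n → ∑ (permsUpTo n) (λ z → ⟦ z ≼? b ⟧ * μ a z) ≡ ⟦ a ≟ b ⟧
∑-μ {n} a b b≤n = by-cases (a ≼? b) (a ≟ b)
  where
  f : Perm → ℤ
  f z = ⟦ z ≼? b ⟧ * μ a z

  f≢0 : ∀ z → f z ≢ 0ℤ → a ≼ z × z ≼ b
  f≢0 z ≢0 = let z≼b , ≢0′ = ⟦⟧*≢0 (z ≼? b) ≢0 in μ≢0 a z ≢0′ , z≼b

  f-below : ∀ z → z ≼ b → f z ≡ μ a z
  f-below z z≼b = ⟦⟧*-true (z ≼? b) z≼b

  interval? : ∀ z → Dec (a ≼ z × z ≺ b)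
  interval? z = a ≼? z ×-dec z ≺? b

  interval⁻ : ∀ {z} → z ∈ᴸ [ a , b ⟩ → a ≼ z × z ≺ b
  interval⁻ z∈ = proj₂ (∈-filter⁻ interval? {xs = permsUpTo (size b)} z∈)

  interval⁺ : ∀ {z} → a ≼ z → z ≺ b → z ∈ᴸ [ a , b ⟩
  interval⁺ {z} a≼z z≺b = ∈-filter⁺ interval? (∈-permsUpTo⁺ (ℕ.<⇒≤ (≺⇒size< {z} {b} z≺b))) (a≼z , z≺b)

  by-cases : Dec (a ≼ b) → Dec (a ≡ b) → ∑ (permsUpTo n) f ≡ ⟦ a ≟ b ⟧
  by-cases _ (yes refl) = trans
    (∑-single f (permsUpTo! n) (∈-permsUpTo⁺ b≤n) λ {z} _ ≢0 →
      let a≼z , z≼a = f≢0 z ≢0 in ≼-antisym z a z≼a a≼z)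
    (trans (f-below a (≼-refl a)) (trans (μ-refl {a}) (sym (⟦⟧-true (a ≟ a) refl))))
  by-cases (no a⋠b) (no a≢b) = trans
    (decidable-stable (∑ (permsUpTo n) f ℤ.≟ 0ℤ) λ ≢0 →
      let z , _ , ≢0′ = ∑≢0 (permsUpTo n) f ≢0
          a≼z , z≼b = f≢0 z ≢0′
      in a⋠b (≼-trans a z b a≼z z≼b))
    (sym (⟦⟧-false (a ≟ b) a≢b))
  by-cases (yes a≼b) (no a≢b) = begin
    -- Only `b` and the half-open interval can carry nonzero terms, and the recursion makes `μ a b`
    -- cancel the rest.
    ∑ (permsUpTo n) f                       ≡⟨ ∑-support f (permsUpTo! n)
                                                 (All.tabulate (λ { z∈ refl → proj₂ (proj₂ (interval⁻ z∈)) refl })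
                                                   ∷ Unique.filter⁺ interval? (permsUpTo! (size b)))
                                                 (λ {z} _ → below z) (λ {z} _ → up-to z) ⟩
    f b ℤ.+ ∑ [ a , b ⟩ f                   ≡⟨ cong₂ ℤ._+_ (f-below b (≼-refl b))
                                                 (∑-cong-∈ [ a , b ⟩ λ {z} z∈ → f-below z (proj₁ (proj₂ (interval⁻ z∈)))) ⟩
    μ a b ℤ.+ ∑ [ a , b ⟩ (μ a)             ≡⟨ cong (ℤ._+ ∑ [ a , b ⟩ (μ a)) (μ-≺ {a} {b} (a≼b , a≢b)) ⟩
    - ∑ [ a , b ⟩ (μ a) ℤ.+ ∑ [ a , b ⟩ (μ a) ≡⟨ ℤ.+-inverseˡ (∑ [ a , b ⟩ (μ a)) ⟩
    0ℤ                                      ≡⟨ ⟦⟧-false (a ≟ b) a≢b ⟨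
    ⟦ a ≟ b ⟧                               ∎
    where
    open ≡-Reasoning
    below : ∀ z → f z ≢ 0ℤ → z ∈ᴸ (b ∷ [ a , b ⟩)
    below z ≢0 = let a≼z , z≼b = f≢0 z ≢0 in
      [ here , (λ z≢b → there (interval⁺ a≼z (z≼b , z≢b))) ]′ (toSum (z ≟ b))
    up-to : ∀ z → f z ≢ 0ℤ → z ∈ᴸ permsUpTo n
    up-to z ≢0 = ∈-permsUpTo⁺ (ℕ.≤-trans (≼⇒size≤ z b (proj₂ (f≢0 z ≢0))) b≤n)

-- Möbius inversion of the weight sums

proposition27 : (σ π : Perm) → σ ≼ π → Single σ π →
    μ σ π ≡ -1ℤ ^ (size π ∸ size σ) * + NE σ π
proposition27 σ π σ≼π single = begin
  μ σ π
    ≡⟨ ℤ.*-identityʳ _ ⟨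
  μ σ π * 1ℤ
    ≡⟨ cong (μ σ π *_) (∑-weight-refl π) ⟨
  μ σ π * above π
    ≡⟨ ∑-single (λ z → μ σ z * above z) {xs = L} (permsUpTo! (size π)) {y = π} (∈-permsUpTo⁺ {π = π} ℕ.≤-refl) (λ {z} _ → only-π z) ⟨
  ∑ L (λ z → μ σ z * above z)
    ≡⟨ ∑-cong L (λ z → ∑-*ˡ (μ σ z) L _) ⟩
  ∑ L (λ z → ∑ L (λ τ → μ σ z * (⟦ z ≼? τ ⟧ * weight π τ)))
    ≡⟨ ∑-swap L L _ ⟩
  ∑ L (λ τ → ∑ L (λ z → μ σ z * (⟦ z ≼? τ ⟧ * weight π τ)))
    ≡⟨ ∑-cong L (λ τ → trans (∑-cong L (λ z → rotate (μ σ z) ⟦ z ≼? τ ⟧ (weight π τ))) (sym (∑-*ˡ (weight π τ) L _))) ⟩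
  ∑ L (λ τ → weight π τ * below τ)
    ≡⟨ ∑-single (λ τ → weight π τ * below τ) {xs = L} (permsUpTo! (size π)) {y = σ} (∈-permsUpTo⁺ {π = σ} (≼⇒size≤ σ π σ≼π)) (λ {τ} _ → only-σ τ) ⟩
  weight π σ * below σ
    ≡⟨ cong (weight π σ *_) (trans (∑-μ σ σ (≼⇒size≤ σ π σ≼π)) (⟦⟧-true (σ ≟ σ) refl)) ⟩
  weight π σ * 1ℤ
    ≡⟨ ℤ.*-identityʳ _ ⟩
  weight π σ ∎
  where
  open ≡-Reasoning
  L = perms π
  above below : Perm → ℤ
  above z = ∑ L (λ τ → ⟦ z ≼? τ ⟧ * weight π τ)
  below τ = ∑ L (λ z → ⟦ z ≼? τ ⟧ * μ σ z)

  rotate : ∀ x y z → x * (y * z) ≡ z * (y * x)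
  rotate = solve-∀

  -- The single-block hypothesis speaks only of the interval. A nonzero `μ σ z` puts `z` above `σ`,
  -- and a nonzero weight of some `τ` containing `z` puts it below `π`.
  only-π : ∀ z → μ σ z * above z ≢ 0ℤ → z ≡ π
  only-π z ≢0 = decidable-stable (z ≟ π) λ z≢π →
    let τ , _ , ≢0′  = ∑≢0 L _ (λ ≡0 → ≢0 (trans (cong (μ σ z *_) ≡0) (ℤ.*-zeroʳ (μ σ z))))
        z≼τ , ≢0″    = ⟦⟧*≢0 (z ≼? τ) ≢0′
        z≼π          = ≼-trans z τ π z≼τ (weight≢0 π τ ≢0″)
        σ≼z          = μ≢0 σ z λ ≡0 → ≢0 (cong (_* above z) ≡0)
    in ≢0 (trans (cong (μ σ z *_) (∑-weight-block π z (single z σ≼z (z≼π , z≢π)))) (ℤ.*-zeroʳ (μ σ z)))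

  -- The inner sum is the Kronecker delta of `∑-μ`; a nonzero weight puts `τ` below `π`, hence
  -- within the size bound of `L`.
  only-σ : ∀ τ → weight π τ * below τ ≢ 0ℤ → τ ≡ σ
  only-σ τ ≢0 = decidable-stable (τ ≟ σ) λ τ≢σ →
    let τ≼π = weight≢0 π τ λ ≡0 → ≢0 (cong (_* below τ) ≡0)
    in ≢0 (trans (cong (weight π τ *_) (trans (∑-μ σ τ (≼⇒size≤ τ π τ≼π)) (⟦⟧-false (σ ≟ τ) (τ≢σ ∘ sym))))
                 (ℤ.*-zeroʳ (weight π τ)))
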